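{- Let $\mathcal{F}_1,\ldots,\mathcal{F}_n$ be finite families of convex subsets of $\mathbb{R}^d$. If $\bigcap\mathcal{F}_i=\emptyset$ for all $i\in[n]$ and $n\ge d+2$, then $\mathbf{RG}_{\mathrm{CH}}(\mathcal{F}_1,\ldots,\mathcal{F}_n)$ is connected.
   Context: $\mathbf{RG}_{\mathrm{CH}}(\mathcal{F}_1,\ldots,\mathcal{F}_n)$ is the graph whose vertices are the ordered tuples $(C_1,\ldots,C_n)$ with $C_i\in\mathcal{F}_i$ for all $i$ and $\bigcap_{i=1}^n C_i=\emptyset$; two tuples $(C_1,\ldots,C_n)$ and $(D_1,\ldots,D_n)$ are adjacent if there is a unique index $j$ with $C_j\neq D_j$ and moreover $\bigcap_{i\neq j}C_i=\emptyset$. -}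

module Defs where

open import Algebra.Bundles using (CommutativeRing)
open import Data.Fin.Base using (Fin)
open import Data.List.Base using (List; length; lookup)
import Data.List.Membership.Setoid as Membership
open import Data.Nat.Base using (ℕ)
open import Data.Product.Base using (Σ; ∃; _×_; _,_; proj₁)
open import Data.Product using (∃!)
open import Data.Vec.Functional using (Vector)
import Data.Vec.Functional.Relation.Binary.Equality.Setoid as VectorEquality
open import Function.Base using (_∘_)
open import Level using (Level; 0ℓ; _⊔_) renaming (suc to lsuc)
open import Relation.Binary.Bundles using (Setoid)
open import Relation.Binary.Construct.Closure.ReflexiveTransitive using (Star)
import Relation.Binary.Construct.On as On
open import Relation.Binary.Core using (Rel)
open import Relation.Binary.Definitions using (_Respects_)
open import Relation.Binary.PropositionalEquality.Core using (_≡_; _≢_)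
open import Relation.Binary.Structures using (IsTotalOrder)
open import Relation.Nullary.Negation.Core using (¬_)
open import Relation.Unary using (Pred; _∈_; _≐_; Empty; Satisfiable; ⋂)
open import Relation.Unary.Relation.Binary.Equality using (≐-setoid)

-- ℝ is given by its characterisation, unique up to isomorphism, as a
-- Dedekind-complete ordered field.  Equality is the setoid equality _≈_ of
-- the underlying ring.  Assuming excluded middle, Dedekind cuts of ℚ
-- (as functions ℚ → Bool) form an inhabitant.

record RealField : Set₁ where
  infix 4 _≤_
  field
    commutativeRing : CommutativeRing 0ℓ 0ℓ

  open CommutativeRing commutativeRing public

  field
    _≤_          : Rel Carrier 0ℓ
    isTotalOrder : IsTotalOrder _≈_ _≤_
    0≉1          : ¬ (0# ≈ 1#)
    inverse      : ∀ x → ¬ (x ≈ 0#) → ∃ λ y → x * y ≈ 1#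
    +-monoˡ-≤    : ∀ z {x y} → x ≤ y → x + z ≤ y + z
    *-nonNeg     : ∀ {x y} → 0# ≤ x → 0# ≤ y → 0# ≤ x * y

  UpperBound : Pred Carrier 0ℓ → Pred Carrier 0ℓ
  UpperBound S b = ∀ x → x ∈ S → x ≤ b

  field
    supremum : (S : Pred Carrier 0ℓ) → Satisfiable S → Satisfiable (UpperBound S) →
               ∃ λ s → s ∈ UpperBound S × (∀ b → b ∈ UpperBound S → s ≤ b)

-- Vertices form a setoid, so a walk may end at any representative of its
-- final vertex.  As usual, a connected graph has at least one vertex.

record Graph (a ℓ r : Level) : Set (lsuc (a ⊔ ℓ ⊔ r)) where
  field
    vertices : Setoid a ℓ
    Adjacent : Rel (Setoid.Carrier vertices) r

Connected : ∀ {a ℓ r} → Graph a ℓ r → Set (a ⊔ ℓ ⊔ r)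
Connected G = Carrier × (∀ u v → ∃ λ w → Star Adjacent u w × w ≈ v)
  where
  open Graph G
  open Setoid vertices

module Euclidean (ℝ : RealField) (d : ℕ) where
  open RealField ℝ

  Point : Set
  Point = Vector Carrier d

  open VectorEquality setoid public using () renaming (_≋_ to _≈ₚ_)

  Subset : Set₁
  Subset = Pred Point 0ℓ

  subsetSetoid : Setoid _ _
  subsetSetoid = ≐-setoid Point 0ℓ

  open Membership subsetSetoid public using () renaming (_∈_ to _∈ᶠ_)

  segmentPoint : Carrier → Point → Point → Point
  segmentPoint t x y i = (1# - t) * x i + t * y i

  -- The first field says that C is a well-defined subset of the setoid ℝᵈ.
  record IsConvexSubset (C : Subset) : Set where
    field
      respects : C Respects _≈ₚ_
      convex   : ∀ {x y} → x ∈ C → y ∈ C →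
                 ∀ t → 0# ≤ t → t ≤ 1# → segmentPoint t x y ∈ C

  -- A finite family is the finite set of subsets occurring in a list, up to
  -- extensional equality; order and repetitions are irrelevant.
  Family : Set₁
  Family = List Subset

  -- The intersection of the empty family is all of ℝᵈ.
  ⋂ᶠ : Family → Subset
  ⋂ᶠ F = ⋂ (Fin (length F)) (lookup F)

  module _ {n : ℕ} (F : Fin n → Family) where

    record Vertex : Set₁ where
      field
        sets         : Vector Subset n
        member       : ∀ i → sets i ∈ᶠ F i
        intersection : Empty (⋂ (Fin n) sets)

    open Vertex

    RG-CH : Graph _ _ _
    RG-CH = record
      { vertices = On.setoid (VectorEquality.≋-setoid subsetSetoid n) sets
      ; Adjacent = λ C D →
          Σ (∃! _≡_ λ j → ¬ (sets C j ≐ sets D j)) λ (j , _) →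
            Empty (⋂ (∃ λ i → i ≢ j) (sets C ∘ proj₁))
      }

{-# OPTIONS --safe #-}
-- The nerve of finitely many convex sets in ℝᵈ is d-collapsible (Wegner): it
-- can be reduced to nothing by repeatedly deleting all faces between some σ
-- with at most d elements and the unique maximal face τ containing σ.  To find
-- σ, shrink the sets to polytopes, let m be the highest among the
-- colexicographic minima of the common parts of the faces, and take a minimal
-- σ whose sets have no common point below m; Radon's argument bounds its size.
-- Cutting all sets off at m, after a slight relaxation of those outside σ,
-- realises the collapsed nerve by convex sets again.
--
-- The graph of a nerve with no faces is connected, and connectedness survives
-- undoing a collapse.  Transversals which contain σ but are not contained in τ
-- are all joined to one another, because τ contains no whole family and at
-- least two colours do not occur in σ.  An edge lost by undoing the collapse
-- joins two transversals containing σ, so walks can be rerouted through these.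
module Submission where

open import Defs
open import Algebra.Bundles using (CommutativeRing)
open import Algebra.Solver.Ring.AlmostCommutativeRing using (fromCommutativeRing; _-Raw-AlmostCommutative⟶_)
open import Axiom.ExcludedMiddle using (ExcludedMiddle)
open import Data.Empty using (⊥)
open import Data.Fin.Base using (Fin; zero; suc; toℕ; fromℕ<; inject≤; punchIn; punchOut)
import Data.Fin.Properties as Finₚ
open import Data.Integer.Base as ℤ using (ℤ; +_; -[1+_])
import Data.Integer.Properties as ℤₚ
open import Data.List.Base using (List; []; _∷_; _++_; map; concat; filter; length; lookup; allFin; cartesianProduct; cartesianProductWith)
open import Data.List.Membership.Propositional using (_∈_; lose)
open import Data.List.Membership.Propositional.Properties using (∈-allFin; ∈-filter⁺; ∈-filter⁻; ∈-map⁺; ∈-lookup; ∈-cartesianProduct⁺; ∈-cartesianProductWith⁺; ∈-concat⁺′)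
import Data.List.Properties as Listₚ
open import Data.List.Relation.Unary.All as All using (All; []; _∷_)
import Data.List.Relation.Unary.All.Properties as Allₚ
open import Data.List.Relation.Unary.Any as Any using (Any; here; there)
import Data.List.Relation.Unary.Any.Properties as Anyₚ
open import Data.Maybe.Base using (Maybe; just; nothing)
open import Data.Nat.Base as ℕ using (ℕ; zero; suc; s≤s; z≤n)
import Data.Nat.Properties as ℕₚ
open import Data.Product.Base using (∃; _×_; _,_; proj₁; proj₂)
open import Data.Sum.Base using (_⊎_; inj₁; inj₂; [_,_]′)
open import Data.Unit.Base using (⊤; tt)
open import Data.Vec.Functional using (Vector; insertAt) renaming (_∷_ to _◂_)
import Data.Vec.Functional.Properties as Vecₚ
open import Function.Base using (_∘_; id)
open import Level using (0ℓ)
open import Relation.Binary.Construct.Closure.ReflexiveTransitive using (Star; _◅_; _◅◅_; reverse) renaming (ε to done)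
open import Relation.Binary.Definitions using (tri<; tri≈; tri>)
open import Relation.Binary.PropositionalEquality.Core as ≡ using (_≡_; _≢_; _≗_)
open import Relation.Binary.Structures using (IsTotalOrder)
open import Relation.Nullary using (¬_; Dec; yes; no; contradiction)
open import Relation.Nullary.Decidable.Core using (decidable-stable)
open import Relation.Unary using (Pred; Empty; Satisfiable; _⊆_; _≐_)
open import Relation.Unary.Properties using (≐-refl; ≐-sym; ≐-trans)

-- The colexicographic order stands in for a generic linear functional: minima over polytopes are
-- unique without any general position, and the points below `m` form a convex set, to which Radon's
-- argument applies as to any other. A set containing `m` need not reach below it, so cutting off at
-- `m` alone would also destroy faces that do not contain `σ`. The relaxation prevents this, but it
-- must not create faces either. Disjoint closed convex sets can be at distance zero, and then every
-- relaxation makes them meet; for polytopes a small one is harmless, because Fourier-Motzkin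
-- elimination can be carried out with the amount of relaxation as a parameter. This is the second
-- reason for passing to polytopes, besides the existence of minima. A collapse ends in convex sets
-- indexed by the same elements, so the induction runs over families of convex sets and never over
-- abstract complexes.

-- The library's ring solver cancels terms only over coefficients with
-- decidable equality, hence the homomorphism from ℤ.
module IntegerCoefficientSolver {c ℓ} (R : CommutativeRing c ℓ) where
  open CommutativeRing R
  open import Algebra.Properties.Ring ring
  open import Algebra.Properties.AbelianGroup +-abelianGroup using (⁻¹-∙-comm)
  open import Algebra.Properties.Semiring.Mult.TCOptimised semiring using (1+×; ×-homo-+; ×1-homo-*) renaming (_×_ to _∙_)
  open import Relation.Binary.Reasoning.Setoid setoid

  -- The optimised multiple reduces `1 ∙ 1#` to `1#`, so that the literal `con (+ 1)` in solver
  -- calls denotes `1#` itself.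
  fromℤ : ℤ → Carrier
  fromℤ (+ n)    = n ∙ 1#
  fromℤ -[1+ n ] = - (suc n ∙ 1#)

  fromℤ-⊖ : ∀ m n → fromℤ (m ℤ.⊖ n) ≈ m ∙ 1# - n ∙ 1#
  fromℤ-⊖ m       zero    = sym (trans (+-congˡ -0#≈0#) (+-identityʳ _))
  fromℤ-⊖ zero    (suc n) = sym (+-identityˡ _)
  fromℤ-⊖ (suc m) (suc n) = begin
    fromℤ (suc m ℤ.⊖ suc n)               ≡⟨ ≡.cong fromℤ (ℤₚ.[1+m]⊖[1+n]≡m⊖n m n) ⟩
    fromℤ (m ℤ.⊖ n)                       ≈⟨ fromℤ-⊖ m n ⟩
    m ∙ 1# - n ∙ 1#                     ≈⟨ +-congʳ (+-identityˡ _) ⟨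
    0# + m ∙ 1# - n ∙ 1#                ≈⟨ +-congʳ (+-congʳ (-‿inverseʳ 1#)) ⟨
    1# - 1# + m ∙ 1# - n ∙ 1#           ≈⟨ +-congʳ (trans (+-assoc _ _ _) (+-congˡ (+-comm _ _))) ⟩
    1# + (m ∙ 1# - 1#) - n ∙ 1#         ≈⟨ trans (+-congʳ (sym (+-assoc _ _ _))) (+-assoc _ _ _) ⟩
    1# + m ∙ 1# + (- 1# - n ∙ 1#)       ≈⟨ +-cong (sym (1+× m 1#)) (trans (⁻¹-∙-comm 1# (n ∙ 1#)) (-‿cong (sym (1+× n 1#)))) ⟩
    suc m ∙ 1# - suc n ∙ 1#             ∎

  fromℤ-neg : ∀ i → fromℤ (ℤ.- i) ≈ - fromℤ i
  fromℤ-neg (+ zero)  = sym -0#≈0#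
  fromℤ-neg (+ suc n) = refl
  fromℤ-neg -[1+ n ]  = sym (-‿involutive _)

  fromℤ-+ : ∀ i j → fromℤ (i ℤ.+ j) ≈ fromℤ i + fromℤ j
  fromℤ-+ (+ m)    (+ n)    = ×-homo-+ 1# m n
  fromℤ-+ (+ m)    -[1+ n ] = fromℤ-⊖ m (suc n)
  fromℤ-+ -[1+ m ] (+ n)    = trans (fromℤ-⊖ n (suc m)) (+-comm _ _)
  fromℤ-+ -[1+ m ] -[1+ n ] = begin
    - (suc (suc (m ℕ.+ n)) ∙ 1#)        ≡⟨ ≡.cong (λ k → - (suc k ∙ 1#)) (ℕₚ.+-suc m n) ⟨
    - ((suc m ℕ.+ suc n) ∙ 1#)          ≈⟨ -‿cong (×-homo-+ 1# (suc m) (suc n)) ⟩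
    - (suc m ∙ 1# + suc n ∙ 1#)         ≈⟨ ⁻¹-∙-comm _ _ ⟨
    - (suc m ∙ 1#) - suc n ∙ 1#         ∎

  fromℤ-*⁺ : ∀ m j → fromℤ (+ m ℤ.* j) ≈ m ∙ 1# * fromℤ j
  fromℤ-*⁺ m (+ n)    = trans (reflexive (≡.cong fromℤ (≡.sym (ℤₚ.pos-* m n)))) (×1-homo-* m n)
  fromℤ-*⁺ m -[1+ n ] = begin
    fromℤ (+ m ℤ.* -[1+ n ])            ≡⟨ ≡.cong fromℤ (ℤₚ.neg-distribʳ-* (+ m) (+ suc n)) ⟨
    fromℤ (ℤ.- (+ m ℤ.* + suc n))       ≈⟨ fromℤ-neg (+ m ℤ.* + suc n) ⟩
    - fromℤ (+ m ℤ.* + suc n)           ≈⟨ -‿cong (fromℤ-*⁺ m (+ suc n)) ⟩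
    - (m ∙ 1# * suc n ∙ 1#)             ≈⟨ -‿distribʳ-* _ _ ⟩
    m ∙ 1# * - (suc n ∙ 1#)             ∎

  fromℤ-* : ∀ i j → fromℤ (i ℤ.* j) ≈ fromℤ i * fromℤ j
  fromℤ-* (+ m)    j = fromℤ-*⁺ m j
  fromℤ-* -[1+ m ] j = begin
    fromℤ (-[1+ m ] ℤ.* j)              ≡⟨ ≡.cong fromℤ (ℤₚ.neg-distribˡ-* (+ suc m) j) ⟨
    fromℤ (ℤ.- (+ suc m ℤ.* j))         ≈⟨ fromℤ-neg (+ suc m ℤ.* j) ⟩
    - fromℤ (+ suc m ℤ.* j)             ≈⟨ -‿cong (fromℤ-*⁺ (suc m) j) ⟩
    - (suc m ∙ 1# * fromℤ j)            ≈⟨ -‿distribˡ-* _ _ ⟩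
    - (suc m ∙ 1#) * fromℤ j            ∎

  homomorphism : ℤ.+-*-rawRing -Raw-AlmostCommutative⟶ fromCommutativeRing R
  homomorphism = record
    { ⟦_⟧    = fromℤ
    ; +-homo = fromℤ-+
    ; *-homo = fromℤ-*
    ; -‿homo = fromℤ-neg
    ; 0-homo = refl
    ; 1-homo = refl
    }

  _coeff≟_ : ∀ i j → Maybe (fromℤ i ≈ fromℤ j)
  i coeff≟ j with i ℤₚ.≟ j
  ... | yes i≡j = just (reflexive (≡.cong fromℤ i≡j))
  ... | no _    = nothing

  open import Algebra.Solver.Ring ℤ.+-*-rawRing (fromCommutativeRing R) homomorphism _coeff≟_ public
    using (solve; _:=_; _:+_; _:*_; _:-_; :-_; con)

-- Arithmetic of ordered fields

module OrderedField (em : ExcludedMiddle 0ℓ) (ℝ : RealField) where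
  open RealField ℝ hiding (zero) public
  open IsTotalOrder isTotalOrder using (antisym; total; ≤-respˡ-≈; ≤-respʳ-≈) renaming (trans to ≤-trans; reflexive to ≤-reflexive) public
  open IntegerCoefficientSolver commutativeRing public
  open import Algebra.Properties.Ring ring using (-‿involutive; -0#≈0#) public
  open import Relation.Binary.Reasoning.Setoid setoid

  infix 4 _<_

  _<_ : Carrier → Carrier → Set
  x < y = ¬ (y ≤ x)

  ≤-refl : ∀ {x} → x ≤ x
  ≤-refl = ≤-reflexive refl

  <⇒≤ : ∀ {x y} → x < y → x ≤ y
  <⇒≤ {x} {y} x<y = [ id , (λ y≤x → contradiction y≤x x<y) ]′ (total x y)

  ≮⇒≥ : ∀ {x y} → ¬ (x < y) → y ≤ x
  ≮⇒≥ = decidable-stable em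

  <-respʳ-≈ : ∀ {x y z} → y ≈ z → x < y → x < z
  <-respʳ-≈ y≈z x<y z≤x = x<y (≤-respˡ-≈ (sym y≈z) z≤x)

  abstract
    ≤⇒nonNeg : ∀ {x y} → x ≤ y → 0# ≤ y - x
    ≤⇒nonNeg {x} x≤y = ≤-respˡ-≈ (-‿inverseʳ x) (+-monoˡ-≤ (- x) x≤y)

    nonNeg⇒≤ : ∀ {x y z} → 0# ≤ z → z ≈ y - x → x ≤ y
    nonNeg⇒≤ {x} {y} 0≤z eq = ≤-respˡ-≈ (+-identityˡ x) (≤-respʳ-≈
      (trans (+-congʳ eq) (solve 2 (λ x y → y :- x :+ x := y) refl x y)) (+-monoˡ-≤ x 0≤z))

    +-nonNeg : ∀ {x y} → 0# ≤ x → 0# ≤ y → 0# ≤ x + y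
    +-nonNeg {x} {y} 0≤x 0≤y = ≤-trans 0≤y (nonNeg⇒≤ 0≤x (solve 2 (λ x y → x := x :+ y :- y) refl x y))

    neg-nonPos : ∀ {x} → x ≤ 0# → 0# ≤ - x
    neg-nonPos {x} x≤0 = ≤-respʳ-≈ (+-identityˡ (- x)) (≤⇒nonNeg x≤0)

    neg-nonNeg⁻¹ : ∀ {x} → 0# ≤ - x → x ≤ 0#
    neg-nonNeg⁻¹ {x} 0≤-x = nonNeg⇒≤ 0≤-x (sym (+-identityˡ (- x)))

    pos⇒≉0 : ∀ {x} → 0# < x → ¬ (x ≈ 0#)
    pos⇒≉0 0<x x≈0 = 0<x (≤-reflexive x≈0)

    0≤1 : 0# ≤ 1#
    0≤1 = [ id , (λ 1≤0 → ≤-respʳ-≈ (solve 0 (:- con (+ 1) :* (:- con (+ 1)) := con (+ 1)) refl)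
      (*-nonNeg (neg-nonPos 1≤0) (neg-nonPos 1≤0))) ]′ (total 0# 1#)

    0<1 : 0# < 1#
    0<1 1≤0 = 0≉1 (antisym 0≤1 1≤0)

    +-pos : ∀ {x y} → 0# < x → 0# ≤ y → 0# < x + y
    +-pos {x} {y} 0<x 0≤y x+y≤0 = 0<x (≤-trans (nonNeg⇒≤ 0≤y (solve 2 (λ x y → y := x :+ y :- x) refl x y)) x+y≤0)

    reciprocal : ∀ {x} → 0# < x → ∃ λ y → 0# < y × x * y ≈ 1#
    reciprocal {x} 0<x with inverse x (pos⇒≉0 0<x)
    ... | y , xy≈1 = y , 0<y , xy≈1
      where
      0<y : 0# < y
      0<y y≤0 = 0<1 (neg-nonNeg⁻¹ (≤-respʳ-≈ (trans (solve 2 (λ x y → x :* (:- y) := :- (x :* y)) refl x y) (-‿cong xy≈1))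
        (*-nonNeg (<⇒≤ 0<x) (neg-nonPos y≤0))))

    *-cancel-nonNeg : ∀ {a x} → 0# < a → 0# ≤ a * x → 0# ≤ x
    *-cancel-nonNeg {a} {x} 0<a 0≤ax with reciprocal 0<a
    ... | b , 0<b , ab≈1 = ≤-respʳ-≈
      (trans (solve 3 (λ a b x → b :* (a :* x) := a :* b :* x) refl a b x) (trans (*-congʳ ab≈1) (*-identityˡ x)))
      (*-nonNeg (<⇒≤ 0<b) 0≤ax)

    *-pos : ∀ {x y} → 0# < x → 0# < y → 0# < x * y
    *-pos {x} {y} 0<x 0<y xy≤0 = 0<y (neg-nonNeg⁻¹ (*-cancel-nonNeg 0<x
      (≤-respʳ-≈ (solve 2 (λ x y → :- (x :* y) := x :* (:- y)) refl x y) (neg-nonPos xy≤0))))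

  data Sign (x : Carrier) : Set where
    isZero : x ≈ 0# → Sign x
    isPos  : 0# < x → Sign x
    isNeg  : 0# < - x → Sign x

  abstract
    sign : ∀ x → Sign x
    sign x with em {0# < x} | em {0# < - x}
    ... | yes 0<x | _        = isPos 0<x
    ... | no _    | yes 0<-x = isNeg 0<-x
    ... | no 0≮x  | no 0≮-x  = isZero (antisym (≮⇒≥ 0≮x) (≤-respʳ-≈ (-‿involutive x) (neg-nonPos (≮⇒≥ 0≮-x))))

    -- Closure of Q under minima is automatic because the order is total.
    lowerBound : ∀ (Q : Carrier → Set) {b} → Q b → ∀ {xs} → All Q xs → ∃ λ t → Q t × t ≤ b × All (t ≤_) xs
    lowerBound Q {b} Qb [] = b , Qb , ≤-refl , []
    lowerBound Q {b} Qb {x ∷ xs} (Qx ∷ Qxs) with lowerBound Q Qb Qxs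
    ... | t , Qt , t≤b , t≤xs with total t x
    ...   | inj₁ t≤x = t , Qt , t≤b , t≤x ∷ t≤xs
    ...   | inj₂ x≤t = x , Qx , ≤-trans x≤t t≤b , ≤-refl ∷ All.map (≤-trans x≤t) t≤xs

    maximum : ∀ b xs → ∃ λ t → b ≤ t × All (_≤ t) xs × (∀ {u} → b ≤ u → All (_≤ u) xs → t ≤ u)
    maximum b []       = b , ≤-refl , [] , λ b≤u _ → b≤u
    maximum b (x ∷ xs) with maximum b xs
    ... | t , b≤t , xs≤t , least with total t x
    ...   | inj₁ t≤x = x , ≤-trans b≤t t≤x , ≤-refl ∷ All.map (λ y≤t → ≤-trans y≤t t≤x) xs≤t , λ { _ (x≤u ∷ _) → x≤u }
    ...   | inj₂ x≤t = t , b≤t , x≤t ∷ xs≤t , λ { b≤u (_ ∷ xs≤u) → least b≤u xs≤u }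

    *-nonPos : ∀ {x y} → 0# ≤ x → y ≤ 0# → x * y ≤ 0#
    *-nonPos {x} {y} 0≤x y≤0 = neg-nonNeg⁻¹
      (≤-respʳ-≈ (solve 2 (λ x y → x :* (:- y) := :- (x :* y)) refl x y) (*-nonNeg 0≤x (neg-nonPos y≤0)))

    -- Here `r` is the reciprocal of `1# + v`, so `η * r * v` equals `η - η * r`, which is strictly
    -- below `η`. Dividing by `1# + v` instead of `v` covers `v ≈ 0#`.
    small-multiple⁺ : ∀ {v η r} → 0# ≤ v → 0# < η → 0# < r → (1# + v) * r ≈ 1# →
                      ∀ {δ} → δ ≤ η * r → δ * v < η
    small-multiple⁺ {v} {η} {r} 0≤v 0<η 0<r eq {δ} δ≤ηr η≤δv = *-pos 0<η 0<r (neg-nonNeg⁻¹ (≤-respʳ-≈ calc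
      (+-nonNeg (≤⇒nonNeg η≤δv) (*-nonNeg (≤⇒nonNeg δ≤ηr) 0≤v))))
      where
      calc : δ * v - η + (η * r - δ) * v ≈ - (η * r)
      calc = begin
        δ * v - η + (η * r - δ) * v      ≈⟨ solve 4 (λ d v e r → d :* v :- e :+ (e :* r :- d) :* v
                                              := e :* ((con (+ 1) :+ v) :* r :- con (+ 1)) :- e :* r) refl δ v η r ⟩
        η * ((1# + v) * r - 1#) - η * r  ≈⟨ +-congʳ (*-congˡ (trans (+-congʳ eq) (-‿inverseʳ 1#))) ⟩
        η * 0# - η * r                   ≈⟨ trans (+-congʳ (zeroʳ η)) (+-identityˡ _) ⟩
        - (η * r)                        ∎

    small-multiple : ∀ v {η} → 0# < η → ∃ λ δ → 0# < δ × (∀ {δ′} → 0# ≤ δ′ → δ′ ≤ δ → δ′ * v < η)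
    small-multiple v {η} 0<η with total 0# v
    ... | inj₂ v≤0 = 1# , 0<1 , λ 0≤δ′ _ η≤δv → 0<η (≤-trans η≤δv (*-nonPos 0≤δ′ v≤0))
    ... | inj₁ 0≤v = let r , 0<r , eq = reciprocal (+-pos 0<1 0≤v) in
      η * r , *-pos 0<η 0<r , λ _ δ′≤δ → small-multiple⁺ 0≤v 0<η 0<r eq δ′≤δ

  -- The colexicographic order

  Vec : ℕ → Set
  Vec = Vector Carrier

  -- The negative cone of the order comparing last coordinates first.
  Neg : ∀ {n} → Vec n → Set
  Neg {zero}  u = ⊥
  Neg {suc n} u = Neg (u ∘ suc) ⊎ ((∀ i → u (suc i) ≈ 0#) × 0# < - u zero)

  abstract
    Neg-resp : ∀ {n} {u v : Vec n} → (∀ i → u i ≈ v i) → Neg u → Neg v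
    Neg-resp {suc n} eq (inj₁ neg)       = inj₁ (Neg-resp (eq ∘ suc) neg)
    Neg-resp {suc n} eq (inj₂ (zs , lt)) = inj₂ ((λ i → trans (sym (eq (suc i))) (zs i)) , <-respʳ-≈ (-‿cong (eq zero)) lt)

    Neg-+ : ∀ {n} {u v : Vec n} → Neg u → Neg v ⊎ (∀ i → v i ≈ 0#) → Neg (λ i → u i + v i)
    Neg-+ {suc n} (inj₁ p) (inj₁ (inj₁ q)) = inj₁ (Neg-+ p (inj₁ q))
    Neg-+ {suc n} (inj₁ p) (inj₁ (inj₂ (zs , _))) = inj₁ (Neg-+ p (inj₂ zs))
    Neg-+ {suc n} (inj₁ p) (inj₂ zs) = inj₁ (Neg-+ p (inj₂ (zs ∘ suc)))
    Neg-+ {suc n} (inj₂ (zs , _)) (inj₁ (inj₁ q)) =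
      inj₁ (Neg-resp (λ i → trans (sym (+-identityˡ _)) (+-congʳ (sym (zs i)))) q)
    Neg-+ {suc n} {u} {v} (inj₂ (zs , lt)) (inj₁ (inj₂ (zs′ , lt′))) =
      inj₂ ((λ i → trans (+-cong (zs i) (zs′ i)) (+-identityˡ 0#)) ,
        <-respʳ-≈ (solve 2 (λ a b → :- a :+ (:- b) := :- (a :+ b)) refl (u zero) (v zero)) (+-pos lt (<⇒≤ lt′)))
    Neg-+ {suc n} {u} {v} (inj₂ (zs , lt)) (inj₂ zs′) =
      inj₂ ((λ i → trans (+-cong (zs i) (zs′ (suc i))) (+-identityˡ 0#)) ,
        <-respʳ-≈ (-‿cong (sym (trans (+-congˡ (zs′ zero)) (+-identityʳ _)))) lt)

    Neg-* : ∀ {n t} {u : Vec n} → 0# < t → Neg u → Neg (λ i → t * u i)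
    Neg-* {suc n} 0<t (inj₁ p) = inj₁ (Neg-* 0<t p)
    Neg-* {suc n} {t} {u} 0<t (inj₂ (zs , lt)) = inj₂ ((λ i → trans (*-congˡ (zs i)) (zeroʳ _)) ,
      <-respʳ-≈ (solve 2 (λ t a → t :* (:- a) := :- (t :* a)) refl t (u zero)) (*-pos 0<t lt))

    Neg⇒≉0 : ∀ {n} {u : Vec n} → Neg u → ¬ (∀ i → u i ≈ 0#)
    Neg⇒≉0 {suc n} (inj₁ p)        zs = Neg⇒≉0 p (zs ∘ suc)
    Neg⇒≉0 {suc n} (inj₂ (_ , lt)) zs = pos⇒≉0 lt (trans (-‿cong (zs zero)) -0#≈0#)

    Neg-trichotomy : ∀ {n} (u : Vec n) → Neg u ⊎ (∀ i → u i ≈ 0#) ⊎ Neg (λ i → - u i)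
    Neg-trichotomy {zero}  u = inj₂ (inj₁ λ ())
    Neg-trichotomy {suc n} u with Neg-trichotomy (u ∘ suc)
    ... | inj₁ p        = inj₁ (inj₁ p)
    ... | inj₂ (inj₂ p) = inj₂ (inj₂ (inj₁ p))
    ... | inj₂ (inj₁ zs) with sign (u zero)
    ...   | isZero z = inj₂ (inj₁ λ { zero → z ; (suc i) → zs i })
    ...   | isPos p  = inj₂ (inj₂ (inj₂ ((λ i → trans (-‿cong (zs i)) -0#≈0#) , <-respʳ-≈ (sym (-‿involutive _)) p)))
    ...   | isNeg p  = inj₁ (inj₂ (zs , p))

  infix 4 _≺_ _≼_

  _≺_ _≼_ : ∀ {n} → Vec n → Vec n → Set
  x ≺ y = Neg (λ i → x i - y i)
  x ≼ y = x ≺ y ⊎ (∀ i → x i ≈ y i)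

  abstract
    ≺-trans-≼ : ∀ {n} {x y z : Vec n} → x ≺ y → y ≼ z → x ≺ z
    ≺-trans-≼ {x = x} {y} {z} p q = Neg-resp (λ i → solve 3 (λ x y z → (x :- y) :+ (y :- z) := x :- z) refl (x i) (y i) (z i))
      (Neg-+ p ([ inj₁ , (λ eq → inj₂ λ i → trans (+-congʳ (eq i)) (-‿inverseʳ _)) ]′ q))

    ≼-trans : ∀ {n} {x y z : Vec n} → x ≼ y → y ≼ z → x ≼ z
    ≼-trans (inj₁ p)  q         = inj₁ (≺-trans-≼ p q)
    ≼-trans (inj₂ eq) (inj₁ q)  = inj₁ (Neg-resp (λ i → +-congʳ (sym (eq i))) q)
    ≼-trans (inj₂ eq) (inj₂ eq′) = inj₂ λ i → trans (eq i) (eq′ i)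

    ≺-irrefl : ∀ {n} {x : Vec n} → ¬ (x ≺ x)
    ≺-irrefl p = Neg⇒≉0 p (λ i → -‿inverseʳ _)

    ≺-or-≽ : ∀ {n} (x y : Vec n) → x ≺ y ⊎ y ≼ x
    ≺-or-≽ x y with Neg-trichotomy (λ i → x i - y i)
    ... | inj₁ p        = inj₁ p
    ... | inj₂ (inj₁ zs) = inj₂ (inj₂ λ i → trans (solve 2 (λ x y → y := x :- (x :- y)) refl (x i) (y i))
                             (trans (+-congˡ (trans (-‿cong (zs i)) -0#≈0#)) (+-identityʳ _)))
    ... | inj₂ (inj₂ p) = inj₂ (inj₁ (Neg-resp (λ i → solve 2 (λ x y → :- (x :- y) := y :- x) refl (x i) (y i)) p))

-- Fourier-Motzkin elimination with parameters

module LinearInequalities (em : ExcludedMiddle 0ℓ) (ℝ : RealField) where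
  open OrderedField em ℝ
  open import Relation.Binary.Reasoning.Setoid setoid

  -- A linear form a · x + b s + c ε in a point x and two parameters:
  -- s homogenises, and ε is the amount by which a constraint is relaxed.
  infixr 5 _▸_
  data Form : ℕ → Set where
    base : (b c : Carrier) → Form zero
    _▸_  : ∀ {n} (a : Carrier) (f : Form n) → Form (suc n)

  ⟦_⟧ : ∀ {n} → Form n → Vec n → Carrier → Carrier → Carrier
  ⟦ base b c ⟧ x s ε = b * s + c * ε
  ⟦ a ▸ f ⟧    x s ε = a * x zero + ⟦ f ⟧ (x ∘ suc) s ε

  Sat : ∀ {n} → List (Form n) → Vec n → Carrier → Carrier → Set
  Sat fs x s ε = All (λ f → 0# ≤ ⟦ f ⟧ x s ε) fs

  scale : ∀ {n} → Carrier → Form n → Form n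
  scale r (base b c) = base (r * b) (r * c)
  scale r (a ▸ f)    = (r * a) ▸ scale r f

  infixl 6 _⊖_
  _⊖_ : ∀ {n} → Form n → Form n → Form n
  base b c ⊖ base b′ c′ = base (b - b′) (c - c′)
  (a ▸ f)  ⊖ (a′ ▸ f′)  = (a - a′) ▸ (f ⊖ f′)

  abstract
    ⟦⟧-scale : ∀ {n} r (f : Form n) x s ε → ⟦ scale r f ⟧ x s ε ≈ r * ⟦ f ⟧ x s ε
    ⟦⟧-scale r (base b c) x s ε =
      solve 5 (λ r b c s e → r :* b :* s :+ r :* c :* e := r :* (b :* s :+ c :* e)) refl r b c s ε
    ⟦⟧-scale r (a ▸ f) x s ε = trans (+-congˡ (⟦⟧-scale r f (x ∘ suc) s ε))
      (solve 4 (λ r a t v → r :* a :* t :+ r :* v := r :* (a :* t :+ v)) refl r a (x zero) (⟦ f ⟧ (x ∘ suc) s ε))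

    ⟦⟧-⊖ : ∀ {n} (f g : Form n) x s ε → ⟦ f ⊖ g ⟧ x s ε ≈ ⟦ f ⟧ x s ε - ⟦ g ⟧ x s ε
    ⟦⟧-⊖ (base b c) (base b′ c′) x s ε =
      solve 6 (λ b c b′ c′ s e → (b :- b′) :* s :+ (c :- c′) :* e := b :* s :+ c :* e :- (b′ :* s :+ c′ :* e)) refl b c b′ c′ s ε
    ⟦⟧-⊖ (a ▸ f) (a′ ▸ f′) x s ε = trans (+-congˡ (⟦⟧-⊖ f f′ (x ∘ suc) s ε))
      (solve 5 (λ a a′ t v v′ → (a :- a′) :* t :+ (v :- v′) := a :* t :+ v :- (a′ :* t :+ v′)) refl
        a a′ (x zero) (⟦ f ⟧ (x ∘ suc) s ε) (⟦ f′ ⟧ (x ∘ suc) s ε))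

    ⟦⟧-linear : ∀ {n} (f : Form n) r r′ x s ε x′ s′ ε′ →
                ⟦ f ⟧ (λ i → r * x i + r′ * x′ i) (r * s + r′ * s′) (r * ε + r′ * ε′) ≈ r * ⟦ f ⟧ x s ε + r′ * ⟦ f ⟧ x′ s′ ε′
    ⟦⟧-linear (base b c) r r′ x s ε x′ s′ ε′ = begin
      b * (r * s + r′ * s′) + c * (r * ε + r′ * ε′)
        ≈⟨ +-cong (lemma b s s′) (lemma c ε ε′) ⟩
      (r * (b * s) + r′ * (b * s′)) + (r * (c * ε) + r′ * (c * ε′))
        ≈⟨ solve 6 (λ r r′ p q p′ q′ → (r :* p :+ r′ :* p′) :+ (r :* q :+ r′ :* q′) := r :* (p :+ q) :+ r′ :* (p′ :+ q′)) refl
             r r′ (b * s) (c * ε) (b * s′) (c * ε′) ⟩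
      r * (b * s + c * ε) + r′ * (b * s′ + c * ε′) ∎
      where
      lemma : ∀ b s s′ → b * (r * s + r′ * s′) ≈ r * (b * s) + r′ * (b * s′)
      lemma b s s′ = solve 5 (λ b r s r′ s′ → b :* (r :* s :+ r′ :* s′) := r :* (b :* s) :+ r′ :* (b :* s′)) refl b r s r′ s′
    ⟦⟧-linear (a ▸ f) r r′ x s ε x′ s′ ε′ = trans (+-congˡ (⟦⟧-linear f r r′ (x ∘ suc) s ε (x′ ∘ suc) s′ ε′))
      (solve 7 (λ a r r′ t t′ v v′ → a :* (r :* t :+ r′ :* t′) :+ (r :* v :+ r′ :* v′) := r :* (a :* t :+ v) :+ r′ :* (a :* t′ :+ v′)) refl
        a r r′ (x zero) (x′ zero) (⟦ f ⟧ (x ∘ suc) s ε) (⟦ f ⟧ (x′ ∘ suc) s′ ε′))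

    ⟦⟧-cong : ∀ {n} (f : Form n) {x x′ s s′ ε ε′} → (∀ i → x i ≈ x′ i) → s ≈ s′ → ε ≈ ε′ → ⟦ f ⟧ x s ε ≈ ⟦ f ⟧ x′ s′ ε′
    ⟦⟧-cong (base _ _) x≈ s≈ ε≈ = +-cong (*-congˡ s≈) (*-congˡ ε≈)
    ⟦⟧-cong (_ ▸ f)    x≈ s≈ ε≈ = +-cong (*-congˡ (x≈ zero)) (⟦⟧-cong f (x≈ ∘ suc) s≈ ε≈)

  Sat-cong : ∀ {n} {fs : List (Form n)} {x x′ s s′ ε ε′} → (∀ i → x i ≈ x′ i) → s ≈ s′ → ε ≈ ε′ → Sat fs x s ε → Sat fs x′ s′ ε′
  Sat-cong x≈ s≈ ε≈ = All.map (λ {f} → ≤-respʳ-≈ (⟦⟧-cong f x≈ s≈ ε≈))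

  -- Divided by the absolute value of its first coefficient, an inequality bounds the first
  -- coordinate from below or from above by a form in the others; if that coefficient is zero, it is
  -- `free`.
  record Split (n : ℕ) : Set where
    constructor split
    field
      free lower upper : List (Form n)

  record SatSplit {n} (S : Split n) (t : Carrier) (x : Vec n) (s ε : Carrier) : Set where
    constructor satSplit
    open Split S
    field
      satFree  : Sat free x s ε
      satLower : All (λ f → ⟦ f ⟧ x s ε ≤ t) lower
      satUpper : All (λ f → t ≤ ⟦ f ⟧ x s ε) upper

  open Split
  open SatSplit

  module _ {n : ℕ} where
    reciprocalOf : ∀ {a} → 0# < a → Carrier
    reciprocalOf = proj₁ ∘ reciprocal

    insert : ∀ {a} → Sign a → Form n → Split n → Split n
    insert (isZero _) f S = record S { free = f ∷ free S }
    insert (isPos p)  f S = record S { lower = scale (- reciprocalOf p) f ∷ lower S }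
    insert (isNeg p)  f S = record S { upper = scale (reciprocalOf p) f ∷ upper S }

    splitForms : List (Form (suc n)) → Split n
    splitForms []             = split [] [] []
    splitForms ((a ▸ f) ∷ fs) = insert (sign a) f (splitForms fs)

    abstract
      lower-eq : ∀ {a t r v} → a * r ≈ 1# → r * (a * t + v) ≈ t - - r * v
      lower-eq {a} {t} {r} {v} ar≈1 = begin
        r * (a * t + v)      ≈⟨ solve 4 (λ r a t v → r :* (a :* t :+ v) := a :* r :* t :- (:- r) :* v) refl r a t v ⟩
        a * r * t - - r * v  ≈⟨ +-congʳ (trans (*-congʳ ar≈1) (*-identityˡ t)) ⟩
        t - - r * v          ∎

      upper-eq : ∀ {a t r v} → - a * r ≈ 1# → r * (a * t + v) ≈ r * v - t
      upper-eq {a} {t} {r} {v} ar≈1 = begin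
        r * (a * t + v)          ≈⟨ solve 4 (λ r a t v → r :* (a :* t :+ v) := r :* v :- (:- a) :* r :* t) refl r a t v ⟩
        r * v - - a * r * t      ≈⟨ +-congˡ (-‿cong (trans (*-congʳ ar≈1) (*-identityˡ t))) ⟩
        r * v - t                ∎

      insert-sound : ∀ {a} (σ : Sign a) f {S t x s ε} → 0# ≤ a * t + ⟦ f ⟧ x s ε → SatSplit S t x s ε → SatSplit (insert σ f S) t x s ε
      insert-sound (isZero a≈0) f 0≤ (satSplit z l u) =
        satSplit (≤-respʳ-≈ (trans (+-congʳ (trans (*-congʳ a≈0) (zeroˡ _))) (+-identityˡ _)) 0≤ ∷ z) l u
      insert-sound (isPos p) f {x = x} {s} {ε} 0≤ (satSplit z l u) = let r , 0<r , eq = reciprocal p in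
        satSplit z (≤-respˡ-≈ (sym (⟦⟧-scale _ f x s ε)) (nonNeg⇒≤ (*-nonNeg (<⇒≤ 0<r) 0≤) (lower-eq eq)) ∷ l) u
      insert-sound (isNeg p) f {x = x} {s} {ε} 0≤ (satSplit z l u) = let r , 0<r , eq = reciprocal p in
        satSplit z l (≤-respʳ-≈ (sym (⟦⟧-scale _ f x s ε)) (nonNeg⇒≤ (*-nonNeg (<⇒≤ 0<r) 0≤) (upper-eq eq)) ∷ u)

      insert-complete : ∀ {a} (σ : Sign a) f {S t x s ε} → SatSplit (insert σ f S) t x s ε → (0# ≤ a * t + ⟦ f ⟧ x s ε) × SatSplit S t x s ε
      insert-complete (isZero a≈0) f (satSplit (0≤f ∷ z) l u) =
        ≤-respʳ-≈ (sym (trans (+-congʳ (trans (*-congʳ a≈0) (zeroˡ _))) (+-identityˡ _))) 0≤f , satSplit z l u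
      insert-complete (isPos p) f {x = x} {s} {ε} (satSplit z (f≤t ∷ l) u) = let r , 0<r , eq = reciprocal p in
        *-cancel-nonNeg 0<r (≤-respʳ-≈ (sym (lower-eq eq)) (≤⇒nonNeg (≤-respˡ-≈ (⟦⟧-scale _ f x s ε) f≤t))) , satSplit z l u
      insert-complete (isNeg p) f {x = x} {s} {ε} (satSplit z l (t≤f ∷ u)) = let r , 0<r , eq = reciprocal p in
        *-cancel-nonNeg 0<r (≤-respʳ-≈ (sym (upper-eq eq)) (≤⇒nonNeg (≤-respʳ-≈ (⟦⟧-scale _ f x s ε) t≤f))) , satSplit z l u

      split-sound : ∀ fs {x s ε} → Sat fs x s ε → SatSplit (splitForms fs) (x zero) (x ∘ suc) s ε
      split-sound []             []        = satSplit [] [] []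
      split-sound ((a ▸ f) ∷ fs) (0≤ ∷ sat) = insert-sound (sign a) f 0≤ (split-sound fs sat)

      split-complete : ∀ fs {x s ε} → SatSplit (splitForms fs) (x zero) (x ∘ suc) s ε → Sat fs x s ε
      split-complete []             _   = []
      split-complete ((a ▸ f) ∷ fs) sat = let 0≤ , sat′ = insert-complete (sign a) f sat in 0≤ ∷ split-complete fs sat′

    -- A first coordinate exists iff every lower bound is at most every upper bound. The parameters
    -- `s` and `ε` are carried along and never eliminated.
    eliminate : List (Form (suc n)) → List (Form n)
    eliminate fs = free S ++ cartesianProductWith (λ l u → u ⊖ l) (lower S) (upper S)
      where S = splitForms fs

    eliminate-sound : ∀ fs {x s ε} → Sat fs x s ε → Sat (eliminate fs) (x ∘ suc) s ε
    eliminate-sound fs {x} {s} {ε} sat = Allₚ.++⁺ (satFree sat′) (pairs (satLower sat′) (satUpper sat′))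
      where
      sat′ = split-sound fs sat
      pair : ∀ {l us} → ⟦ l ⟧ (x ∘ suc) s ε ≤ x zero → All (λ u → x zero ≤ ⟦ u ⟧ (x ∘ suc) s ε) us → Sat (map (_⊖ l) us) (x ∘ suc) s ε
      pair l≤t = Allₚ.map⁺ ∘ All.map (λ {u} t≤u → ≤-respʳ-≈ (sym (⟦⟧-⊖ u _ (x ∘ suc) s ε)) (≤⇒nonNeg (≤-trans l≤t t≤u)))
      pairs : ∀ {ls us} → All (λ l → ⟦ l ⟧ (x ∘ suc) s ε ≤ x zero) ls → All (λ u → x zero ≤ ⟦ u ⟧ (x ∘ suc) s ε) us →
              Sat (cartesianProductWith (λ l u → u ⊖ l) ls us) (x ∘ suc) s ε
      pairs []         us≥ = []
      pairs (l≤ ∷ ls≤) us≥ = Allₚ.++⁺ (pair l≤ us≥) (pairs ls≤ us≥)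

    eliminate-complete : ∀ fs {x s ε} → Sat (eliminate fs) x s ε → ∃ λ t → Sat fs (t ◂ x) s ε
    eliminate-complete fs {x} {s} {ε} sat =
      let t , ls≤t , t≤us = between (lower S) (upper S) (Allₚ.++⁻ʳ (free S) sat)
      in t , split-complete fs (satSplit (Allₚ.++⁻ˡ (free S) sat) ls≤t t≤us)
      where
      S = splitForms fs
      val : Form n → Carrier
      val f = ⟦ f ⟧ x s ε
      below : ∀ l us → Sat (map (_⊖ l) us) x s ε → All (λ u → val l ≤ val u) us
      below l us p = All.map (λ {u} 0≤ → nonNeg⇒≤ 0≤ (⟦⟧-⊖ u l x s ε)) (Allₚ.map⁻ p)
      between : ∀ ls us → Sat (cartesianProductWith (λ l u → u ⊖ l) ls us) x s ε →
                ∃ λ t → All (λ l → val l ≤ t) ls × All (λ u → t ≤ val u) us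
      -- With no lower bounds, any value below all the upper ones will do; `0#` only starts the
      -- minimum.
      between [] us _ = let t , _ , _ , t≤us = lowerBound (λ _ → ⊤) {0#} tt {map val us} (All.tabulate (λ _ → tt))
                        in t , [] , Allₚ.map⁻ t≤us
      between (l ∷ ls) us p with between ls us (Allₚ.++⁻ʳ (map (_⊖ l) us) p)
      ... | t , ls≤t , t≤us with total (val l) t
      ...   | inj₁ l≤t = t , l≤t ∷ ls≤t , t≤us
      ...   | inj₂ t≤l = val l , ≤-refl ∷ All.map (λ l′≤t → ≤-trans l′≤t t≤l) ls≤t , below l us (Allₚ.++⁻ˡ (map (_⊖ l) us) p)

  -- Elimination projects onto the later coordinates, which are the first to be compared. Above the
  -- minimum `m` of the projection the least admissible first coordinate is taken.
  colex-minimum : ∀ {n} (fs : List (Form n)) {s ε b} → (∃ λ x → Sat fs x s ε) → (∀ x → Sat fs x s ε → ∀ i → b ≤ x i) →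
                  ∃ λ m → Sat fs m s ε × (∀ x → Sat fs x s ε → m ≼ x)
  colex-minimum {zero} fs (x , sat) _ = x , sat , λ _ _ → inj₂ λ ()
  colex-minimum {suc n} fs {s} {ε} {b} (x , sat) bound = t ◂ m , sat-m , least
    where
    S = splitForms fs
    ih = colex-minimum (eliminate fs) {s} {ε} {b} (x ∘ suc , eliminate-sound fs sat)
           (λ y sat′ i → let t , sat″ = eliminate-complete fs sat′ in bound (t ◂ y) sat″ (suc i))
    m = proj₁ ih
    -- Starting from `b` gives a value even without lower bounds, and `b` exceeds no admissible
    -- first coordinate.
    bounds = maximum b (map (λ f → ⟦ f ⟧ m s ε) (lower S))
    t = proj₁ bounds
    t-least : ∀ {u} → Sat fs (u ◂ m) s ε → t ≤ u
    t-least {u} satᵤ = proj₂ (proj₂ (proj₂ bounds)) (bound _ satᵤ zero) (Allₚ.map⁺ (satLower (split-sound fs satᵤ)))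
    sat-m : Sat fs (t ◂ m) s ε
    sat-m with eliminate-complete fs (proj₁ (proj₂ ih))
    ... | t₀ , sat₀ with split-sound fs sat₀
    ...   | satSplit z _ u = split-complete fs (satSplit z (Allₚ.map⁻ (proj₁ (proj₂ (proj₂ bounds)))) (All.map (≤-trans (t-least sat₀)) u))
    least : ∀ y → Sat fs y s ε → t ◂ m ≼ y
    least y satᵧ with proj₂ (proj₂ ih) (y ∘ suc) (eliminate-sound fs satᵧ)
    ... | inj₁ m≺y = inj₁ (inj₁ m≺y)
    ... | inj₂ m≈y with sign (t - y zero)
    ...   | isPos p = contradiction (neg-nonNeg⁻¹ (≤-respʳ-≈ (solve 2 (λ a b → a :- b := :- (b :- a)) refl (y zero) t)
              (≤⇒nonNeg (t-least (Sat-cong (λ { zero → refl ; (suc i) → sym (m≈y i) }) refl refl satᵧ))))) p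
    ...   | isNeg p  = inj₁ (inj₂ ((λ i → trans (+-congʳ (m≈y i)) (-‿inverseʳ _)) , p))
    ...   | isZero z = inj₂ λ { zero → trans (solve 2 (λ a b → a := (a :- b) :+ b) refl t (y zero)) (trans (+-congʳ z) (+-identityˡ _)) ; (suc i) → m≈y i }

  Robust : ∀ {n} → List (Form n) → Set
  Robust fs = ∃ λ δ → 0# < δ × (∀ {ε} → 0# ≤ ε → ε ≤ δ → ¬ (∃ λ x → Sat fs x 1# ε))

  robust₀ : (fs : List (Form zero)) → ¬ (∃ λ x → Sat fs x 1# 0#) → Robust fs
  robust₀ [] infeasible = contradiction ((λ ()) , []) infeasible
  robust₀ ((base b c) ∷ fs) infeasible with em {0# ≤ b * 1# + c * 0#}
  ... | yes 0≤b = let δ , 0<δ , p = robust₀ fs (λ { (x , sat) → infeasible (x , 0≤b ∷ sat) })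
                  in δ , 0<δ , λ { 0≤ε ε≤δ (x , _ ∷ sat) → p 0≤ε ε≤δ (x , sat) }
  ... | no 0≰b  = let δ , 0<δ , p = small-multiple c 0<-b in δ , 0<δ , λ { {ε} 0≤ε ε≤δ (x , 0≤ ∷ _) → p 0≤ε ε≤δ
                    (nonNeg⇒≤ 0≤ (solve 3 (λ b c e → b :* con (+ 1) :+ c :* e := e :* c :- (:- b)) refl b c ε)) }
    where
    0<-b : 0# < - b
    0<-b -b≤0 = 0≰b (≤-respʳ-≈ (solve 2 (λ b c → :- (:- b) := b :* con (+ 1) :+ c :* con (+ 0)) refl b c) (neg-nonPos -b≤0))

  -- Elimination leaves finitely many conditions `0# ≤ b + c * ε` without variables. One of them is
  -- violated at `ε = 0#`, and it stays violated for small `ε`.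
  robust : ∀ {n} (fs : List (Form n)) → ¬ (∃ λ x → Sat fs x 1# 0#) → Robust fs
  robust {zero}  fs infeasible = robust₀ fs infeasible
  robust {suc n} fs infeasible =
    let δ , 0<δ , p = robust (eliminate fs) (λ { (x , sat) → infeasible (_ , proj₂ (eliminate-complete fs sat)) })
    in δ , 0<δ , λ { 0≤ε ε≤δ (x , sat) → p 0≤ε ε≤δ (x ∘ suc , eliminate-sound fs sat) }

-- Linear dependence by Gaussian elimination

module Dependence (em : ExcludedMiddle 0ℓ) (ℝ : RealField) where
  open OrderedField em ℝ
  open import Algebra.Properties.Semiring.Sum semiring public
    using (sum; sum-cong-≋; sum-remove; ∑-distrib-+; *-distribʳ-sum; sum-replicate-zero)
  open import Relation.Binary.Reasoning.Setoid setoid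

  sum-zero : ∀ {n} {u : Vec n} → (∀ i → u i ≈ 0#) → sum u ≈ 0#
  sum-zero {n} zs = trans (sum-cong-≋ zs) (sum-replicate-zero n)

  sum-*1 : ∀ {n} (u : Vec n) → sum (λ i → u i * 1#) ≈ sum u
  sum-*1 u = sum-cong-≋ {x = λ i → u i * 1#} {u} (λ i → *-identityʳ (u i))

  pivot-eq : ∀ {k} (c a b : Vec k) r →
             - (sum (λ l → c l * a l) * r) + sum (λ l → c l * b l) ≈ sum (λ l → c l * (b l - a l * r))
  pivot-eq c a b r = begin
    - (sum (λ l → c l * a l) * r) + sum (λ l → c l * b l)
      ≈⟨ solve 3 (λ s r t → :- (s :* r) :+ t := t :+ s :* (:- r)) refl (sum (λ l → c l * a l)) r (sum (λ l → c l * b l)) ⟩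
    sum (λ l → c l * b l) + sum (λ l → c l * a l) * - r
      ≈⟨ +-congˡ (*-distribʳ-sum (- r) (λ l → c l * a l)) ⟩
    sum (λ l → c l * b l) + sum (λ l → c l * a l * - r)
      ≈⟨ ∑-distrib-+ (λ l → c l * b l) (λ l → c l * a l * - r) ⟨
    sum (λ l → c l * b l + c l * a l * - r)
      ≈⟨ sum-cong-≋ (λ l → solve 4 (λ c b a r → c :* b :+ c :* a :* (:- r) := c :* (b :- a :* r)) refl (c l) (b l) (a l) r) ⟩
    sum (λ l → c l * (b l - a l * r)) ∎

  -- If the first coordinate vanishes on all vectors, it is dropped. Otherwise multiples of one
  -- vector clear it from the others, and a dependence of these extends to the pivot.
  dependence : ∀ {n k} (v : Fin k → Vec n) → n ℕ.< k →
               ∃ λ (c : Vec k) → (∃ λ i → ¬ (c i ≈ 0#)) × (∀ j → sum (λ i → c i * v i j) ≈ 0#)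
  dependence {zero}  {suc k} v _ = (λ _ → 1#) , (zero , λ 1≈0 → 0≉1 (sym 1≈0)) , λ ()
  dependence {suc n} {suc k} v (s≤s n<k) with em {∃ λ i → ¬ (v i zero ≈ 0#)}
  ... | no all-zero =
    let c , nz , eq = dependence (λ i → v i ∘ suc) (ℕₚ.m≤n⇒m≤1+n n<k)
    in c , nz , λ { zero    → sum-zero {u = λ i → c i * v i zero} (λ i → trans (*-congˡ (decidable-stable em (λ nz → all-zero (i , nz)))) (zeroʳ (c i)))
                  ; (suc j) → eq j }
  ... | yes (i₀ , nz₀) with inverse (v i₀ zero) nz₀
  ...   | r , pr≈1 = c , nonzero , vanishing
    where
    p : Carrier
    p = v i₀ zero
    a : Vec k
    a l = v (punchIn i₀ l) zero
    ih = dependence (λ l j → v (punchIn i₀ l) (suc j) - a l * (r * v i₀ (suc j))) n<k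
    c′ : Vec k
    c′ = proj₁ ih
    S : Carrier
    S = sum (λ l → c′ l * a l)
    -- The coefficient of the pivot is forced by the vanishing of the first coordinate.
    c : Vec (suc k)
    c = insertAt c′ i₀ (- (S * r))
    c-pivot : c i₀ ≈ - (S * r)
    c-pivot = reflexive (Vecₚ.insertAt-lookup c′ i₀ _)
    c-other : ∀ l → c (punchIn i₀ l) ≈ c′ l
    c-other l = reflexive (Vecₚ.insertAt-punchIn c′ i₀ _ l)
    nonzero : ∃ λ i → ¬ (c i ≈ 0#)
    nonzero = let l , nz = proj₁ (proj₂ ih) in punchIn i₀ l , λ z → nz (trans (sym (c-other l)) z)
    expand : ∀ j → sum (λ i → c i * v i j) ≈ - (S * r) * v i₀ j + sum (λ l → c′ l * v (punchIn i₀ l) j)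
    expand j = trans (sum-remove {i = i₀} (λ i → c i * v i j)) (+-cong (*-congʳ c-pivot) (sum-cong-≋ (λ l → *-congʳ (c-other l))))
    vanishing : ∀ j → sum (λ i → c i * v i j) ≈ 0#
    vanishing zero = begin
      sum (λ i → c i * v i zero) ≈⟨ expand zero ⟩
      - (S * r) * p + S          ≈⟨ solve 3 (λ S r p → :- (S :* r) :* p :+ S := S :* (con (+ 1) :- p :* r)) refl S r p ⟩
      S * (1# - p * r)           ≈⟨ *-congˡ (trans (+-congˡ (-‿cong pr≈1)) (-‿inverseʳ 1#)) ⟩
      S * 0#                     ≈⟨ zeroʳ S ⟩
      0#                         ∎
    vanishing (suc j) = begin
      sum (λ i → c i * v i (suc j))    ≈⟨ expand (suc j) ⟩
      - (S * r) * v i₀ (suc j) + T     ≈⟨ +-congʳ (solve 3 (λ S r x → :- (S :* r) :* x := :- (S :* (r :* x))) refl S r (v i₀ (suc j))) ⟩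
      - (S * (r * v i₀ (suc j))) + T   ≈⟨ pivot-eq c′ a (λ l → v (punchIn i₀ l) (suc j)) (r * v i₀ (suc j)) ⟩
      _                                ≈⟨ proj₂ (proj₂ ih) j ⟩
      0#                               ∎
      where
      T : Carrier
      T = sum (λ l → c′ l * v (punchIn i₀ l) (suc j))

-- Cones over convex sets and Radon's argument

module Convexity (em : ExcludedMiddle 0ℓ) (ℝ : RealField) (d : ℕ) where
  open OrderedField em ℝ
  open LinearInequalities em ℝ
  open Dependence em ℝ
  open Euclidean ℝ d
  open IsConvexSubset
  open import Relation.Binary.Reasoning.Setoid setoid

  -- Homogenisation: the cone over `C` placed at height one, with its apex included. Addition in it
  -- amounts to convex combination with weights that need not be normalised and may vanish.
  Cone : Subset → Carrier → Point → Set
  Cone C s x = (s ≈ 0# × (∀ i → x i ≈ 0#)) ⊎ (0# < s × ∃ λ p → C p × (∀ i → x i ≈ s * p i))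

  cone-resp : ∀ {C s s′ x x′} → s ≈ s′ → (∀ i → x i ≈ x′ i) → Cone C s x → Cone C s′ x′
  cone-resp s≈ x≈ (inj₁ (s≈0 , x≈0)) = inj₁ (trans (sym s≈) s≈0 , λ i → trans (sym (x≈ i)) (x≈0 i))
  cone-resp s≈ x≈ (inj₂ (0<s , p , Cp , eq)) = inj₂ (<-respʳ-≈ s≈ 0<s , p , Cp , λ i → trans (sym (x≈ i)) (trans (eq i) (*-congʳ s≈)))

  cone-point : ∀ {C w p} → 0# ≤ w → w ≈ 0# ⊎ C p → Cone C w (λ i → w * p i)
  cone-point _ (inj₁ w≈0) = inj₁ (w≈0 , λ i → trans (*-congʳ w≈0) (zeroˡ _))
  cone-point {w = w} {p} 0≤w (inj₂ Cp) with em {w ≤ 0#}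
  ... | no 0<w  = inj₂ (0<w , p , Cp , λ _ → refl)
  ... | yes w≤0 = let w≈0 = antisym w≤0 0≤w in inj₁ (w≈0 , λ i → trans (*-congʳ w≈0) (zeroˡ _))

  cone-+ : ∀ {C s s′ x x′} → IsConvexSubset C → Cone C s x → Cone C s′ x′ → Cone C (s + s′) (λ i → x i + x′ i)
  cone-+ cvx (inj₁ (s≈0 , x≈0)) c = cone-resp (trans (sym (+-identityˡ _)) (+-congʳ (sym s≈0)))
    (λ i → trans (sym (+-identityˡ _)) (+-congʳ (sym (x≈0 i)))) c
  cone-+ cvx c@(inj₂ _) (inj₁ (s≈0 , x≈0)) = cone-resp (trans (sym (+-identityʳ _)) (+-congˡ (sym s≈0)))
    (λ i → trans (sym (+-identityʳ _)) (+-congˡ (sym (x≈0 i)))) c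
  cone-+ {C} {s} {s′} {x} {x′} cvx (inj₂ (0<s , p , Cp , eq)) (inj₂ (0<s′ , p′ , Cp′ , eq′)) =
    inj₂ (+-pos 0<s (<⇒≤ 0<s′) , segmentPoint t p p′ , convex cvx Cp Cp′ t 0≤t t≤1 , λ i →
      trans (+-cong (eq i) (eq′ i)) (sym (begin
        (s + s′) * ((1# - t) * p i + t * p′ i)
          ≈⟨ solve 5 (λ s s′ r p p′ → (s :+ s′) :* ((con (+ 1) :- s′ :* r) :* p :+ s′ :* r :* p′)
                       := (s :+ s′) :* p :+ (s :+ s′) :* r :* (s′ :* (p′ :- p))) refl s s′ r (p i) (p′ i) ⟩
        (s + s′) * p i + (s + s′) * r * (s′ * (p′ i - p i))
          ≈⟨ +-congˡ (trans (*-congʳ ur≈1) (*-identityˡ _)) ⟩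
        (s + s′) * p i + s′ * (p′ i - p i)
          ≈⟨ solve 4 (λ s s′ p p′ → (s :+ s′) :* p :+ s′ :* (p′ :- p) := s :* p :+ s′ :* p′) refl s s′ (p i) (p′ i) ⟩
        s * p i + s′ * p′ i ∎)))
    where
    inv = reciprocal (+-pos 0<s (<⇒≤ 0<s′))
    r : Carrier
    r = proj₁ inv
    0≤r : 0# ≤ r
    0≤r = <⇒≤ (proj₁ (proj₂ inv))
    ur≈1 : (s + s′) * r ≈ 1#
    ur≈1 = proj₂ (proj₂ inv)
    t : Carrier
    t = s′ * r
    0≤t : 0# ≤ t
    0≤t = *-nonNeg (<⇒≤ 0<s′) 0≤r
    t≤1 : t ≤ 1#
    t≤1 = nonNeg⇒≤ (*-nonNeg (<⇒≤ 0<s) 0≤r) (trans (solve 3 (λ s s′ r → s :* r := (s :+ s′) :* r :- s′ :* r) refl s s′ r) (+-congʳ ur≈1))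

  cone-pos : ∀ {C s x} → 0# < s → Cone C s x → ∃ λ p → C p × (∀ i → x i ≈ s * p i)
  cone-pos 0<s (inj₁ (s≈0 , _)) = contradiction s≈0 (pos⇒≉0 0<s)
  cone-pos 0<s (inj₂ (_ , p))   = p

  cone-unit : ∀ {C x} → IsConvexSubset C → Cone C 1# x → C x
  cone-unit cvx c = let p , Cp , eq = cone-pos 0<1 c in respects cvx (λ i → sym (trans (eq i) (*-identityˡ _))) Cp

  -- Points of weight zero may lie outside `C`; in Radon's argument this excuses the one point that
  -- is not known to lie in a given set.
  cone-sum : ∀ {C} → IsConvexSubset C → ∀ {k} (w : Vec k) (q : Fin k → Point) → (∀ i → 0# ≤ w i) →
             (∀ i → w i ≈ 0# ⊎ C (q i)) → Cone C (sum w) (λ j → sum (λ i → w i * q i j))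
  cone-sum cvx {zero}  w q _   _  = inj₁ (refl , λ _ → refl)
  cone-sum cvx {suc k} w q 0≤w cs = cone-+ cvx (cone-point {p = q zero} (0≤w zero) (cs zero))
    (cone-sum cvx (w ∘ suc) (q ∘ suc) (0≤w ∘ suc) (cs ∘ suc))

  sum-nonNeg : ∀ {k} {w : Vec k} → (∀ i → 0# ≤ w i) → 0# ≤ sum w
  sum-nonNeg {zero}  0≤w = ≤-refl
  sum-nonNeg {suc k} 0≤w = +-nonNeg (0≤w zero) (sum-nonNeg (0≤w ∘ suc))

  term≤sum : ∀ {k} {w : Vec k} → (∀ i → 0# ≤ w i) → ∀ i → w i ≤ sum w
  term≤sum {suc k} {w} 0≤w i = nonNeg⇒≤ (sum-nonNeg (λ j → 0≤w (punchIn i j)))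
    (trans (solve 2 (λ a b → b := a :+ b :- a) refl (w i) _) (+-congʳ (sym (sum-remove {i = i} w))))

  record Parts (c : Carrier) : Set where
    field
      pos neg  : Carrier
      0≤pos    : 0# ≤ pos
      0≤neg    : 0# ≤ neg
      pos-neg  : c ≈ pos - neg
      disjoint : pos ≈ 0# ⊎ neg ≈ 0#

  parts : ∀ c → Parts c
  parts c with total 0# c
  ... | inj₁ 0≤c = record { pos = c ; neg = 0# ; 0≤pos = 0≤c ; 0≤neg = ≤-refl
                          ; pos-neg = sym (trans (+-congˡ -0#≈0#) (+-identityʳ c)) ; disjoint = inj₂ refl }
  ... | inj₂ c≤0 = record { pos = 0# ; neg = - c ; 0≤pos = ≤-refl ; 0≤neg = neg-nonPos c≤0
                          ; pos-neg = sym (trans (+-identityˡ _) (-‿involutive c)) ; disjoint = inj₁ refl }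

  sum-difference : ∀ {k} (u v : Vec k) → sum (λ i → u i - v i) ≈ 0# → sum u ≈ sum v
  sum-difference u v eq = begin
    sum u                                ≈⟨ sum-cong-≋ (λ i → solve 2 (λ u v → u := (u :- v) :+ v) refl (u i) (v i)) ⟩
    sum (λ i → (u i - v i) + v i)        ≈⟨ ∑-distrib-+ (λ i → u i - v i) v ⟩
    sum (λ i → u i - v i) + sum v        ≈⟨ trans (+-congʳ eq) (+-identityˡ _) ⟩
    sum v                                ∎

  -- Radon's argument: an affine dependence of the points q i is split by the
  -- signs of its coefficients into two convex combinations of the same point.
  helly-step : ∀ {k} → suc d ℕ.< k → (S : Fin k → Subset) → (∀ j → IsConvexSubset (S j)) →
               (q : Fin k → Point) → (∀ i j → i ≢ j → S j (q i)) → ∃ λ z → ∀ j → S j z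
  helly-step {k} d<k S cvx q q∈S = (λ i → r * y i) , inS
    where
    -- The extra coordinate `1#` makes the coefficients sum to zero, so the dependence is affine; it
    -- is also why more than `suc d` points are required.
    dep = dependence (λ i → 1# ◂ q i) d<k
    c : Vec k
    c = proj₁ dep
    module P i = Parts (parts (c i))
    s : Carrier
    s = sum P.pos
    y : Point
    y j = sum (λ i → P.pos i * q i j)
    balance : ∀ (u : Vec k) → sum (λ i → c i * u i) ≈ 0# → sum (λ i → P.pos i * u i) ≈ sum (λ i → P.neg i * u i)
    balance u eq = sum-difference (λ i → P.pos i * u i) (λ i → P.neg i * u i) (trans (sum-cong-≋ (λ i → trans
      (solve 3 (λ p n u → p :* u :- n :* u := (p :- n) :* u) refl (P.pos i) (P.neg i) (u i)) (*-congʳ (sym (P.pos-neg i))))) eq)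
    s≈neg : s ≈ sum P.neg
    s≈neg = trans (sym (sum-*1 P.pos)) (trans (balance (λ _ → 1#) (proj₂ (proj₂ dep) zero)) (sum-*1 P.neg))
    y≈neg : ∀ j → y j ≈ sum (λ i → P.neg i * q i j)
    y≈neg j = balance (λ i → q i j) (proj₂ (proj₂ dep) (suc j))
    -- Were `s` not positive, both parts of every coefficient would vanish, as the two sums agree;
    -- but some coefficient is nonzero.
    0<s : 0# < s
    0<s s≤0 = let i , nz = proj₁ (proj₂ dep) in nz (trans (P.pos-neg i) (trans (+-cong
      (antisym (≤-trans (term≤sum P.0≤pos i) s≤0) (P.0≤pos i))
      (trans (-‿cong (antisym (≤-trans (term≤sum P.0≤neg i) (≤-respˡ-≈ s≈neg s≤0)) (P.0≤neg i))) -0#≈0#)) (+-identityˡ 0#)))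
    inv = reciprocal 0<s
    r : Carrier
    r = proj₁ inv
    except : ∀ {w : Vec k} j → w j ≈ 0# → ∀ i → w i ≈ 0# ⊎ S j (q i)
    except j wj≈0 i with i Finₚ.≟ j
    ... | yes ≡.refl = inj₁ wj≈0
    ... | no i≢j     = inj₂ (q∈S i j i≢j)
    -- In one of the two combinations `q j` has weight zero, and that one uses only points of `S j`.
    cone : ∀ j → Cone (S j) s y
    cone j = [ (λ z → cone-sum (cvx j) P.pos q P.0≤pos (except j z))
             , (λ z → cone-resp (sym s≈neg) (λ i → sym (y≈neg i)) (cone-sum (cvx j) P.neg q P.0≤neg (except j z))) ]′ (P.disjoint j)
    inS : ∀ j → S j (λ i → r * y i)
    inS j = let p , p∈S , eq = cone-pos 0<s (cone j) in respects (cvx j) (λ i → sym (begin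
      r * y i         ≈⟨ *-congˡ (eq i) ⟩
      r * (s * p i)   ≈⟨ solve 3 (λ r s p → r :* (s :* p) := s :* r :* p) refl r s (p i) ⟩
      s * r * p i     ≈⟨ trans (*-congʳ (proj₂ (proj₂ inv))) (*-identityˡ _) ⟩
      p i             ∎)) p∈S

  -- Convex hulls of finitely many points as systems of inequalities

  zeroForm : ∀ n → Form n
  zeroForm zero    = base 0# 0#
  zeroForm (suc n) = 0# ▸ zeroForm n

  ⟦zeroForm⟧ : ∀ n {x s ε} → ⟦ zeroForm n ⟧ x s ε ≈ 0#
  ⟦zeroForm⟧ zero    = trans (+-cong (zeroˡ _) (zeroˡ _)) (+-identityˡ 0#)
  ⟦zeroForm⟧ (suc n) = trans (+-cong (zeroˡ _) (⟦zeroForm⟧ n)) (+-identityˡ 0#)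

  ⟦▸zeroForm⟧ : ∀ {n} a (x : Vec (suc n)) {s ε} → ⟦ a ▸ zeroForm n ⟧ x s ε ≈ a * x zero
  ⟦▸zeroForm⟧ {n} a x = trans (+-congˡ (⟦zeroForm⟧ n)) (+-identityʳ _)

  -- The cone over the empty hull is the apex alone: opposite inequalities pin `s` and every
  -- coordinate to zero.
  originForms : ∀ n → List (Form n)
  originForms zero    = base 1# 0# ∷ base (- 1#) 0# ∷ []
  originForms (suc n) = (1# ▸ zeroForm n) ∷ (- 1# ▸ zeroForm n) ∷ map (0# ▸_) (originForms n)

  pinned : ∀ {t u v} → u ≈ 1# * t → v ≈ - 1# * t → 0# ≤ u → 0# ≤ v → t ≈ 0#
  pinned {t} eq eq′ 0≤u 0≤v = antisym
    (neg-nonNeg⁻¹ (≤-respʳ-≈ (trans eq′ (solve 1 (λ t → (:- con (+ 1)) :* t := :- t) refl t)) 0≤v))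
    (≤-respʳ-≈ (trans eq (*-identityˡ t)) 0≤u)

  originForms-complete : ∀ n {x s} → Sat (originForms n) x s 0# → s ≈ 0# × (∀ i → x i ≈ 0#)
  originForms-complete zero (p ∷ q ∷ []) = pinned (drop 1#) (drop (- 1#)) p q , λ ()
    where
    drop : ∀ a {s} → a * s + 0# * 0# ≈ a * s
    drop a = trans (+-congˡ (zeroˡ 0#)) (+-identityʳ _)
  originForms-complete (suc n) {x} (p ∷ q ∷ ps) =
    let s≈0 , x≈0 = originForms-complete n (All.map (≤-respʳ-≈ (trans (+-congʳ (zeroˡ _)) (+-identityˡ _))) (Allₚ.map⁻ ps))
    in s≈0 , λ { zero → pinned (⟦▸zeroForm⟧ 1# x) (⟦▸zeroForm⟧ (- 1#) x) p q ; (suc i) → x≈0 i }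

  -- (s , x) lies in the cone over conv (p ∷ ps) iff (s - t , x - t p) lies in
  -- the cone over conv ps for some t ≥ 0, and t is then eliminated.
  coneForms : Point → List (Form d) → List (Form (suc d))
  coneForms p fs = (1# ▸ zeroForm d) ∷ map (λ f → - ⟦ f ⟧ p 1# 0# ▸ f) fs

  hullForms : List Point → List (Form d)
  hullForms []       = originForms d
  hullForms (p ∷ ps) = eliminate (coneForms p (hullForms ps))

  -- The weight `t` of the head of the list is `1#` if the point is that head and `0#` if it comes
  -- later.
  point∈hull : ∀ {ps p} → p ∈ ps → Sat (hullForms ps) p 1# 0#
  point∈hull {p ∷ ps} (here ≡.refl) = eliminate-sound (coneForms p (hullForms ps)) {x = 1# ◂ p}
    (≤-respʳ-≈ (sym (trans (⟦▸zeroForm⟧ 1# (1# ◂ p)) (*-identityˡ 1#))) 0≤1 ∷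
     Allₚ.map⁺ (All.tabulate (λ {f} _ → ≤-reflexive (sym (trans (+-congʳ (*-identityʳ _)) (-‿inverseˡ (⟦ f ⟧ p 1# 0#)))))))
  point∈hull {p ∷ ps} {q} (there q∈ps) = eliminate-sound (coneForms p (hullForms ps)) {x = 0# ◂ q}
    (≤-reflexive (sym (trans (⟦▸zeroForm⟧ 1# (0# ◂ q)) (zeroʳ 1#))) ∷
     Allₚ.map⁺ (All.map (≤-respʳ-≈ (sym (trans (+-congʳ (zeroʳ _)) (+-identityˡ _)))) (point∈hull q∈ps)))

  -- The induction has to range over all heights `s`, since removing `t` times the head leaves
  -- height `s - t`.
  hull⊆cone : ∀ {C} → IsConvexSubset C → ∀ {ps} → All C ps → ∀ {x s} → Sat (hullForms ps) x s 0# → Cone C s x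
  hull⊆cone cvx [] sat = inj₁ (originForms-complete d sat)
  hull⊆cone cvx {p ∷ ps} (Cp ∷ Cps) {x} {s} sat with eliminate-complete (coneForms p (hullForms ps)) sat
  ... | t , (0≤t ∷ sat′) = cone-resp (solve 2 (λ s t → t :+ (s :- t) := s) refl s t)
      (λ i → solve 3 (λ x t p → t :* p :+ (x :- t :* p) := x) refl (x i) t (p i))
      (cone-+ cvx (cone-point (≤-respʳ-≈ (trans (⟦▸zeroForm⟧ 1# (t ◂ x)) (*-identityˡ t)) 0≤t) (inj₂ Cp))
                  (hull⊆cone cvx Cps (All.map (λ {f} → ≤-respʳ-≈ (shift f)) (Allₚ.map⁻ sat′))))
    where
    shift : ∀ f → - ⟦ f ⟧ p 1# 0# * t + ⟦ f ⟧ x s 0# ≈ ⟦ f ⟧ (λ i → x i - t * p i) (s - t) 0#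
    shift f = begin
      - ⟦ f ⟧ p 1# 0# * t + ⟦ f ⟧ x s 0#
        ≈⟨ solve 3 (λ a t b → (:- a) :* t :+ b := con (+ 1) :* b :+ (:- t) :* a) refl (⟦ f ⟧ p 1# 0#) t (⟦ f ⟧ x s 0#) ⟩
      1# * ⟦ f ⟧ x s 0# + - t * ⟦ f ⟧ p 1# 0#
        ≈⟨ ⟦⟧-linear f 1# (- t) x s 0# p 1# 0# ⟨
      ⟦ f ⟧ (λ i → 1# * x i + - t * p i) (1# * s + - t * 1#) (1# * 0# + - t * 0#)
        ≈⟨ ⟦⟧-cong f (λ i → solve 3 (λ x t p → con (+ 1) :* x :+ (:- t) :* p := x :- t :* p) refl (x i) t (p i))
             (solve 2 (λ s t → con (+ 1) :* s :+ (:- t) :* con (+ 1) := s :- t) refl s t)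
             (trans (+-cong (zeroʳ _) (zeroʳ _)) (+-identityˡ 0#)) ⟩
      ⟦ f ⟧ (λ i → x i - t * p i) (s - t) 0# ∎

  hull⊆ : ∀ {C} → IsConvexSubset C → ∀ {ps} → All C ps → ∀ {x} → Sat (hullForms ps) x 1# 0# → C x
  hull⊆ cvx Cps sat = cone-unit cvx (hull⊆cone cvx Cps sat)

  ⟦⟧-segment : ∀ (f : Form d) t x y ε → ⟦ f ⟧ (segmentPoint t x y) 1# ε ≈ (1# - t) * ⟦ f ⟧ x 1# ε + t * ⟦ f ⟧ y 1# ε
  ⟦⟧-segment f t x y ε = trans (⟦⟧-cong f (λ _ → refl) (weights 1#) (weights ε)) (⟦⟧-linear f (1# - t) t x 1# ε y 1# ε)
    where
    weights : ∀ s → s ≈ (1# - t) * s + t * s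
    weights s = solve 2 (λ s t → s := (con (+ 1) :- t) :* s :+ t :* s) refl s t

  Sat-convex : ∀ fs ε → IsConvexSubset (λ x → Sat fs x 1# ε)
  Sat-convex fs ε = record
    { respects = λ x≈y → Sat-cong x≈y refl refl
    ; convex   = λ {x} {y} px py t 0≤t t≤1 → All.zipWith (λ {f} (0≤x , 0≤y) → ≤-respʳ-≈ (sym (⟦⟧-segment f t x y ε))
                   (+-nonNeg (*-nonNeg (≤⇒nonNeg t≤1) 0≤x) (*-nonNeg 0≤t 0≤y))) (px , py)
    }

  ∩-convex : ∀ {C D} → IsConvexSubset C → IsConvexSubset D → IsConvexSubset (λ x → C x × D x)
  ∩-convex c c′ = record
    { respects = λ x≈y (p , p′) → respects c x≈y p , respects c′ x≈y p′
    ; convex   = λ (p , p′) (q , q′) t 0≤t t≤1 → convex c p q t 0≤t t≤1 , convex c′ p′ q′ t 0≤t t≤1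
    }

  coordinate-≥-convex : ∀ b i → IsConvexSubset (λ x → b ≤ x i)
  coordinate-≥-convex b i = record
    { respects = λ x≈y → ≤-respʳ-≈ (x≈y i)
    ; convex   = λ {x} {y} b≤x b≤y t 0≤t t≤1 → nonNeg⇒≤
        (+-nonNeg (*-nonNeg (≤⇒nonNeg t≤1) (≤⇒nonNeg b≤x)) (*-nonNeg 0≤t (≤⇒nonNeg b≤y)))
        (solve 4 (λ b t x y → (con (+ 1) :- t) :* (x :- b) :+ t :* (y :- b) := (con (+ 1) :- t) :* x :+ t :* y :- b) refl b t (x i) (y i))
    }

  segment-≺ : ∀ {m x y : Point} {t} → x ≼ m → y ≺ m → 0# < t → t ≤ 1# → segmentPoint t x y ≺ m
  segment-≺ {m} {x} {y} {t} x≼m y≺m 0<t t≤1 = Neg-resp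
    (λ i → solve 4 (λ t x y m → t :* (y :- m) :+ (con (+ 1) :- t) :* (x :- m) := (con (+ 1) :- t) :* x :+ t :* y :- m) refl t (x i) (y i) (m i))
    (Neg-+ (Neg-* 0<t y≺m) (rest x≼m (em {1# - t ≤ 0#})))
    where
    rest : x ≼ m → Dec (1# - t ≤ 0#) → Neg (λ i → (1# - t) * (x i - m i)) ⊎ (∀ i → (1# - t) * (x i - m i) ≈ 0#)
    rest (inj₁ x≺m) (no 0<1-t)  = inj₁ (Neg-* 0<1-t x≺m)
    rest (inj₁ x≺m) (yes 1-t≤0) = inj₂ λ i → trans (*-congʳ (antisym 1-t≤0 (≤⇒nonNeg t≤1))) (zeroˡ _)
    rest (inj₂ x≈m) _           = inj₂ λ i → trans (*-congˡ (trans (+-congʳ (x≈m i)) (-‿inverseʳ _))) (zeroʳ _)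

  -- In general this set is neither open nor closed, but convexity is all that Radon's argument asks
  -- for.
  ≺-convex : ∀ m → IsConvexSubset (_≺ m)
  ≺-convex m = record { respects = λ x≈y → Neg-resp (λ i → +-congʳ (x≈y i)) ; convex = cvx }
    where
    cvx : ∀ {x y} → x ≺ m → y ≺ m → ∀ t → 0# ≤ t → t ≤ 1# → segmentPoint t x y ≺ m
    cvx {x} {y} x≺m y≺m t 0≤t t≤1 with em {t ≤ 0#}
    ... | no 0<t  = segment-≺ (inj₁ x≺m) y≺m 0<t t≤1
    ... | yes t≤0 = Neg-resp (λ i → +-congʳ (trans (solve 2 (λ x y → x := (con (+ 1) :- con (+ 0)) :* x :+ con (+ 0) :* y) refl (x i) (y i))
                      (+-cong (*-congʳ (+-congˡ (-‿cong 0≈t))) (*-congʳ 0≈t)))) x≺m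
      where
      0≈t : 0# ≈ t
      0≈t = antisym 0≤t t≤0

-- Codes for the subsets of a finite set

module Enumeration (em : ExcludedMiddle 0ℓ) {E : Set} (elems : List E) (elems-complete : ∀ e → e ∈ elems) where

  subsets : List E → List (Pred E 0ℓ)
  subsets []       = (λ _ → ⊥) ∷ []
  subsets (e ∷ es) = subsets es ++ map (λ B x → x ≡ e ⊎ B x) (subsets es)

  subsets-complete : ∀ (A : Pred E 0ℓ) es → Any (λ B → B ⊆ A × (∀ {x} → x ∈ es → A x → B x)) (subsets es)
  subsets-complete A []       = here ((λ ()) , λ ())
  subsets-complete A (e ∷ es) with em {A e}
  ... | yes Ae = Anyₚ.++⁺ʳ (subsets es) (Anyₚ.map⁺ (Any.map (λ (B⊆A , A⊆B) →
                   (λ { (inj₁ ≡.refl) → Ae ; (inj₂ Bx) → B⊆A Bx }) ,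
                   λ { (here x≡e) _ → inj₁ x≡e ; (there x∈es) Ax → inj₂ (A⊆B x∈es Ax) }) (subsets-complete A es)))
  ... | no ¬Ae = Anyₚ.++⁺ˡ (Any.map (λ (B⊆A , A⊆B) → (λ {x} → B⊆A {x}) ,
                   λ { (here ≡.refl) Ae → contradiction Ae ¬Ae ; (there x∈es) Ax → A⊆B x∈es Ax }) (subsets-complete A es))

  -- Finitely many codes represent all predicates up to mutual inclusion. Through them one can take
  -- extrema over all faces and bound the number of collapses.
  K : ℕ
  K = length (subsets elems)

  P : Fin K → Pred E 0ℓ
  P = lookup (subsets elems)

  P-complete : ∀ A → ∃ λ k → P k ⊆ A × A ⊆ P k
  P-complete A = let any = subsets-complete A elems ; B⊆A , A⊆B = Anyₚ.lookup-index any
                 in Any.index any , B⊆A , λ {x} → A⊆B (elems-complete x)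

-- Wegner's collapse for convex sets

module Collapsing (em : ExcludedMiddle 0ℓ) (ℝ : RealField) (d : ℕ) {E : Set} (elems : List E) (elems-complete : ∀ e → e ∈ elems) where
  open OrderedField em ℝ
  open LinearInequalities em ℝ
  open Convexity em ℝ d
  open Euclidean ℝ d
  open IsConvexSubset
  open Enumeration em elems elems-complete
  open import Relation.Binary.Reasoning.Setoid setoid

  Common : (E → Subset) → Pred E 0ℓ → Subset
  Common S A x = ∀ {e} → A e → S e x

  Face : (E → Subset) → Pred E 0ℓ → Set
  Face S A = Satisfiable (Common S A)

  -- T realises the nerve of S with the star of σ removed, and τ is the unique
  -- maximal face containing σ.  Only nonempty faces are considered.
  record Collapse (S : E → Subset) : Set₁ where
    field
      T        : E → Subset
      T-convex : ∀ e → IsConvexSubset (T e)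
      size     : ℕ
      size≤d   : size ℕ.≤ d
      σ        : Fin size → E
      τ        : Pred E 0ℓ
      σ⊆τ      : ∀ i → τ (σ i)
      τ-inhabited : Satisfiable τ
      τ-face   : Face S τ
      star⊆τ   : ∀ {A} → Satisfiable A → Face S A → (∀ i → A (σ i)) → A ⊆ τ
      kept     : ∀ {A} → Satisfiable A → Face S A → ¬ (∀ i → A (σ i)) → Face T A
      T⇒S      : ∀ {A} → Face T A → Face S A
      removed  : ∀ {A} → Satisfiable A → (∀ i → A (σ i)) → ¬ Face T A

  module _ (H : E → List (Form d)) (A : Pred E 0ℓ) where
    system : List (Form d)
    system = concat (map H (filter (λ e → em {A e}) elems))

    system-sound : ∀ {x s ε} → (∀ {e} → A e → Sat (H e) x s ε) → Sat system x s ε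
    system-sound sat = Allₚ.concat⁺ (Allₚ.map⁺ (All.map sat (Allₚ.all-filter (λ e → em {A e}) elems)))

    system-complete : ∀ {x s ε} → Sat system x s ε → ∀ {e} → A e → Sat (H e) x s ε
    system-complete sat {e} Ae = All.lookup
      (Allₚ.map⁻ (Allₚ.concat⁻ {xss = map H (filter (λ e → em {A e}) elems)} sat))
      (∈-filter⁺ (λ e → em {A e}) (elems-complete e) Ae)

  -- Slope `1#` relaxes an inequality by `ε` and slope `0#` keeps it rigid; at `ε = 0#` both agree
  -- with the original at `ε = 0#`.
  setSlope : ∀ {n} → Carrier → Form n → Form n
  setSlope c (base b _) = base b c
  setSlope c (a ▸ f)    = a ▸ setSlope c f

  ⟦setSlope⟧ : ∀ {n} c (f : Form n) x s ε → ⟦ setSlope c f ⟧ x s ε ≈ ⟦ f ⟧ x s 0# + c * ε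
  ⟦setSlope⟧ c (base b c′) x s ε = +-congʳ (sym (trans (+-congˡ (zeroʳ c′)) (+-identityʳ _)))
  ⟦setSlope⟧ c (a ▸ f)     x s ε = trans (+-congˡ (⟦setSlope⟧ c f (x ∘ suc) s ε)) (sym (+-assoc _ _ _))

  argmax : ∀ {I : Set} (G : I → Set) (m : I → Point) is →
           (∀ {i} → i ∈ is → ¬ G i) ⊎ ∃ λ k → G k × (∀ {i} → i ∈ is → G i → m i ≼ m k)
  argmax G m [] = inj₁ λ ()
  argmax G m (i ∷ is) with em {G i} | argmax G m is
  ... | no ¬Gi | inj₁ none = inj₁ λ { (here ≡.refl) → ¬Gi ; (there j∈is) → none j∈is }
  ... | no ¬Gi | inj₂ (k , Gk , max) = inj₂ (k , Gk , λ { (here ≡.refl) Gi → contradiction Gi ¬Gi ; (there j∈is) → max j∈is })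
  ... | yes Gi | inj₁ none = inj₂ (i , Gi , λ { (here ≡.refl) _ → inj₂ (λ _ → refl) ; (there j∈is) Gj → contradiction Gj (none j∈is) })
  ... | yes Gi | inj₂ (k , Gk , max) with ≺-or-≽ (m k) (m i)
  ...   | inj₁ k≺i = inj₂ (i , Gi , λ { (here ≡.refl) _ → inj₂ (λ _ → refl) ; (there j∈is) Gj → ≼-trans (max j∈is Gj) (inj₁ k≺i) })
  ...   | inj₂ i≼k = inj₂ (k , Gk , λ { (here ≡.refl) _ → i≼k ; (there j∈is) → max j∈is })

  choose : ∀ {Q : Subset} → Dec (Satisfiable Q) → Point
  choose (yes (x , _)) = x
  choose (no _)        = λ _ → 0#

  choose-spec : ∀ {Q : Subset} (dec : Dec (Satisfiable Q)) → Satisfiable Q → Q (choose dec)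
  choose-spec (yes (_ , Qx)) _  = Qx
  choose-spec (no ¬Q)        sQ = contradiction sQ ¬Q

  -- The sets `S` may be neither closed nor bounded, so their common parts need not have minima.
  -- Polyhedra inside them with the same nerve and a common lower bound on all coordinates do.
  record Polyhedra (S : E → Subset) : Set₁ where
    field
      H : E → List (Form d)

    Q : E → Subset
    Q e x = Sat (H e) x 1# 0#

    field
      Q⊆S     : ∀ {e} → Q e ⊆ S e
      S⇒Q     : ∀ {A} → Face S A → Face Q A
      bottom  : Carrier
      bottom≤ : ∀ {e x} → Q e x → ∀ i → bottom ≤ x i

  module Hulls (S : E → Subset) (S-convex : ∀ e → IsConvexSubset (S e)) where

    -- One point is chosen for each face, and `e` receives the hull of the points of all faces
    -- containing it. So every face keeps its point, and each hull stays inside its convex set.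
    p : Fin K → Point
    p k = choose (em {Face S (P k)})

    InHull : E → Fin K → Set
    InHull e k = P k e × Face S (P k)

    hullPoints : E → List Point
    hullPoints e = map p (filter (λ k → em {InHull e k}) (allFin K))

    H : E → List (Form d)
    H e = hullForms (hullPoints e)

    Q : E → Subset
    Q e x = Sat (H e) x 1# 0#

    Q⊆ : ∀ {C e} → IsConvexSubset C → (∀ {k} → InHull e k → C (p k)) → Q e ⊆ C
    Q⊆ {e = e} cvx pts = hull⊆ cvx (Allₚ.map⁺ (All.map pts (Allₚ.all-filter (λ k → em {InHull e k}) (allFin K))))

    Q⊆S : ∀ {e} → Q e ⊆ S e
    Q⊆S {e} = Q⊆ (S-convex e) (λ {k} (Pke , face) → choose-spec (em {Face S (P k)}) face Pke)

    S⇒Q : ∀ {A} → Face S A → Face Q A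
    S⇒Q {A} (x , x∈) with P-complete A
    ... | k , P⊆A , A⊆P = p k , λ {e} Ae → point∈hull (∈-map⁺ p (∈-filter⁺ (λ k → em {InHull e k}) (∈-allFin k)
                            (A⊆P Ae , x , λ Pe → x∈ (P⊆A Pe))))

    bound : ∃ λ b → ∀ {e x} → Q e x → ∀ i → b ≤ x i
    bound = let b , _ , _ , b≤ = lowerBound (λ _ → ⊤) {0#} tt {coordinates} (All.tabulate (λ _ → tt))
            in b , λ Qx i → Q⊆ (coordinate-≥-convex b i) (λ {k} _ → All.lookup b≤ (∈-cartesianProductWith⁺ p (∈-allFin k) (∈-allFin i))) Qx
      where
      coordinates : List Carrier
      coordinates = cartesianProductWith p (allFin K) (allFin d)

    polyhedra : Polyhedra S
    polyhedra = record { H = H ; Q⊆S = Q⊆S ; S⇒Q = S⇒Q ; bottom = proj₁ bound ; bottom≤ = proj₂ bound }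

  -- The highest minimum and the choice of `σ`

  module _ {S : E → Subset} (poly : Polyhedra S) where
    open Polyhedra poly

    IsMinimum : Pred E 0ℓ → Subset
    IsMinimum A m = Common Q A m × (∀ x → Common Q A x → m ≼ x)

    record Peak : Set₁ where
      field
        A₀          : Pred E 0ℓ
        A₀-inhabited : Satisfiable A₀
        m           : Point
        m-spec      : IsMinimum A₀ m
        low-point   : ∀ {A} → Satisfiable A → Face S A → ∃ λ x → Common Q A x × x ≼ m

    module _ (e₀ : E) (x₀ : Point) (x₀∈S : S e₀ x₀) where

      minimum-exists : ∀ {A} → Satisfiable A → Face Q A → Satisfiable (IsMinimum A)
      minimum-exists {A} (e , Ae) (x , x∈) =
        let m , sat , least = colex-minimum (system H A) {b = bottom} (x , system-sound H A x∈)
                                (λ y sat → bottom≤ (system-complete H A sat Ae))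
        in m , system-complete H A sat , λ y y∈ → least y (system-sound H A y∈)

      Good : Fin K → Set
      Good k = Satisfiable (P k) × Face Q (P k)

      minimum : Fin K → Point
      minimum k = choose (em {Satisfiable (IsMinimum (P k))})

      minimum-spec : ∀ {k} → Good k → IsMinimum (P k) (minimum k)
      minimum-spec {k} (sat , face) = choose-spec (em {Satisfiable (IsMinimum (P k))}) (minimum-exists sat face)

      highest : ∃ λ k → Good k × (∀ {i} → i ∈ allFin K → Good i → minimum i ≼ minimum k)
      highest with argmax Good minimum (allFin K)
      ... | inj₂ max  = max
      -- The singleton of `e₀` is a nonempty face, so not all codes can fail to be `Good`.
      ... | inj₁ none with P-complete (_≡ e₀)
      ...   | k , P⊆ , ⊆P = contradiction ((e₀ , ⊆P ≡.refl) , S⇒Q (x₀ , λ Pe → ≡.subst (λ e → S e x₀) (≡.sym (P⊆ Pe)) x₀∈S)) (none (∈-allFin k))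

      peak : Peak
      peak = record
        { A₀ = P (proj₁ highest) ; A₀-inhabited = proj₁ (proj₁ (proj₂ highest))
        ; m = minimum (proj₁ highest) ; m-spec = minimum-spec (proj₁ (proj₂ highest)) ; low-point = low-point }
        where
        -- The minimum of the face itself is such a point, `m` being the largest of all minima.
        low-point : ∀ {A} → Satisfiable A → Face S A → ∃ λ x → Common Q A x × x ≼ minimum (proj₁ highest)
        low-point {A} (e , Ae) face with P-complete A
        ... | k , P⊆A , A⊆P = minimum k , (λ Ae → proj₁ (minimum-spec good) (A⊆P Ae)) , proj₂ (proj₂ highest) (∈-allFin k) good
          where
          good : Good k
          good = (e , A⊆P Ae) , (let x , x∈ = S⇒Q face in x , λ Pe → x∈ (P⊆A Pe))

  module _ {S : E → Subset} {poly : Polyhedra S} (pk : Peak poly) where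
    open Polyhedra poly
    open Peak pk

    Q-convex : ∀ e → IsConvexSubset (Q e)
    Q-convex e = Sat-convex (H e) 0#

    Blocks : ∀ {k} → (Fin k → E) → Set
    Blocks s = ∀ x → (∀ i → Q (s i) x) → ¬ (x ≺ m)

    -- The field `escape` expresses that `σ` is minimal. Its points serve twice: they enter Radon's
    -- argument, and they show in which direction to leave `m` downwards.
    record Critical : Set where
      field
        {size}  : ℕ
        σ       : Fin size → E
        blocks  : Blocks σ
        m∈      : ∀ i → Q (σ i) m
        escape  : ∀ i → ∃ λ q → (∀ j → j ≢ i → Q (σ j) q) × q ≺ m

    criticalise : ∀ {k} (s : Fin k → E) → Blocks s → (∀ i → Q (s i) m) → Critical
    criticalise {zero}  s blocks m∈ = record { σ = s ; blocks = blocks ; m∈ = m∈ ; escape = λ () }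
    criticalise {suc k} s blocks m∈ with em {∃ λ i → Blocks (s ∘ punchIn i)}
    ... | yes (i , blocks′) = criticalise (s ∘ punchIn i) blocks′ (m∈ ∘ punchIn i)
    ... | no ¬blocks        = record { σ = s ; blocks = blocks ; m∈ = m∈ ; escape = escape }
      where
      escape : ∀ i → ∃ λ q → (∀ j → j ≢ i → Q (s j) q) × q ≺ m
      escape i = decidable-stable em λ ¬escape → ¬blocks (i , λ x x∈ x≺m → ¬escape
        (x , (λ j j≢i → ≡.subst (λ l → Q (s l) x) (Finₚ.punchIn-punchOut (j≢i ∘ ≡.sym)) (x∈ (punchOut (j≢i ∘ ≡.sym)))) , x≺m))

    critical : Critical
    critical = criticalise (lookup list) blocks (λ i → proj₁ m-spec (proj₂ (inList (∈-lookup i))))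
      where
      list : List E
      list = filter (λ e → em {A₀ e}) elems
      inList : ∀ {e} → e ∈ list → e ∈ elems × A₀ e
      inList = ∈-filter⁻ (λ e → em {A₀ e})
      blocks : Blocks (lookup list)
      blocks x x∈ x≺m = ≺-irrefl (≺-trans-≼ x≺m (proj₂ m-spec x λ {e} Ae →
        let e∈list = ∈-filter⁺ (λ e → em {A₀ e}) (elems-complete e) Ae
        in ≡.subst (λ e → Q e x) (≡.sym (Anyₚ.lookup-index e∈list)) (x∈ (Any.index e∈list))))

  module _ {S : E → Subset} {poly : Polyhedra S} {pk : Peak poly} (crit : Critical pk) where
    open Polyhedra poly
    open Peak pk
    open Critical crit

    -- The sets in `σ` and the set of points below `m` have no common point, yet they do once any
    -- one is left out: `m` if it is the latter, an escape point otherwise. By Radon's argument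
    -- there are at most `d + 1` of them.
    size≤d : size ℕ.≤ d
    size≤d with size ℕₚ.≤? d
    ... | yes size≤d = size≤d
    ... | no size≰d  = let z , z∈ = helly-step (s≤s (ℕₚ.≰⇒> size≰d)) sets sets-convex points points∈
                       in contradiction (z∈ zero) (blocks z (z∈ ∘ suc))
      where
      sets : Fin (suc size) → Subset
      sets zero    = _≺ m
      sets (suc j) = Q (σ j)
      sets-convex : ∀ j → IsConvexSubset (sets j)
      sets-convex zero    = ≺-convex m
      sets-convex (suc j) = Q-convex pk (σ j)
      points : Fin (suc size) → Point
      points zero    = m
      points (suc i) = proj₁ (escape i)
      points∈ : ∀ i j → i ≢ j → sets j (points i)
      points∈ zero    zero    0≢0 = contradiction ≡.refl 0≢0
      points∈ zero    (suc j) _   = m∈ j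
      points∈ (suc i) zero    _   = proj₂ (proj₂ (escape i))
      points∈ (suc i) (suc j) i≢j = proj₁ (proj₂ (escape i)) j (λ j≡i → i≢j (≡.cong suc (≡.sym j≡i)))

    τ : Pred E 0ℓ
    τ e = Q e m

    -- A face containing `σ` has a common point at or below `m`. As `σ` blocks everything strictly
    -- below, this point is `m`.
    star⊆τ : ∀ {A} → Satisfiable A → Face S A → (∀ i → A (σ i)) → A ⊆ τ
    star⊆τ sat face σ⊆A {e} Ae with low-point sat face
    ... | x , x∈ , inj₁ x≺m = contradiction x≺m (blocks x (λ i → x∈ (σ⊆A i)))
    ... | x , x∈ , inj₂ x≈m = respects (Q-convex pk e) x≈m (x∈ Ae)

    -- Relaxing the sets outside σ lets every face through m that misses some
    -- σ i reach below m, while the sets in σ still do not meet there.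
    InΣ : E → Set
    InΣ e = ∃ λ i → σ i ≡ e

    slope : ∀ {X : Set} → Dec X → Carrier
    slope (yes _) = 0#
    slope (no _)  = 1#

    0≤slope : ∀ {X : Set} (dec : Dec X) → 0# ≤ slope dec
    0≤slope (yes _) = ≤-refl
    0≤slope (no _)  = 0≤1

    H⁺ : E → List (Form d)
    H⁺ e = map (setSlope (slope (em {InΣ e}))) (H e)

    H⁺-0 : ∀ {e x} → Sat (H⁺ e) x 1# 0# → Q e x
    H⁺-0 {e} {x} sat = All.map (λ {f} → ≤-respʳ-≈ (trans (⟦setSlope⟧ _ f x 1# 0#) (trans (+-congˡ (zeroʳ _)) (+-identityʳ _)))) (Allₚ.map⁻ sat)

    Slack : Set
    Slack = ∃ λ ε → 0# < ε × (∀ k → ¬ Face Q (P k) → ¬ (∃ λ x → Sat (system H⁺ (P k)) x 1# ε))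

    -- The least of finitely many tolerances from `robust`, one for each code; codes of faces impose
    -- no bound beyond `1#`.
    slack : Slack
    slack = let ε , 0<ε , _ , ε≤ = lowerBound (0# <_) 0<1 {map δ (allFin K)}
                                   (Allₚ.map⁺ (All.tabulate (λ {k} _ → proj₁ (proj₂ (tolerance k (em {Face Q (P k)}))))))
            in ε , 0<ε , λ k ¬face → proj₂ (proj₂ (tolerance k (em {Face Q (P k)}))) ¬face (<⇒≤ 0<ε)
                 (All.lookup ε≤ (∈-map⁺ δ (∈-allFin k)))
      where
      tolerance : ∀ k → Dec (Face Q (P k)) → ∃ λ δ → 0# < δ ×
                  (¬ Face Q (P k) → ∀ {ε} → 0# ≤ ε → ε ≤ δ → ¬ (∃ λ x → Sat (system H⁺ (P k)) x 1# ε))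
      tolerance k (yes face) = 1# , 0<1 , λ ¬face → contradiction face ¬face
      tolerance k (no ¬face) = let δ , 0<δ , p = robust (system H⁺ (P k))
                                                   (λ (x , sat) → ¬face (x , λ Pe → H⁺-0 (system-complete H⁺ (P k) sat Pe)))
                               in δ , 0<δ , λ _ → p
      δ : Fin K → Carrier
      δ k = proj₁ (tolerance k (em {Face Q (P k)}))

  -- Realising the collapsed nerve by convex sets

  module _ {S : E → Subset} {poly : Polyhedra S} {pk : Peak poly} {crit : Critical pk} (slk : Slack crit) where
    open Polyhedra poly
    open Peak pk
    open Critical crit

    ε : Carrier
    ε = proj₁ slk

    0<ε : 0# < ε
    0<ε = proj₁ (proj₂ slk)

    T : E → Subset
    T e x = Sat (H⁺ crit e) x 1# ε × x ≺ m

    T⇒S : ∀ {A} → Face T A → Face S A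
    T⇒S {A} (x , x∈) with P-complete A
    ... | k , P⊆A , A⊆P = let y , y∈ = (decidable-stable em λ ¬face → proj₂ (proj₂ slk) k ¬face
                                  (x , system-sound (H⁺ crit) (P k) (λ Pe → proj₁ (x∈ (P⊆A Pe)))))
                          in y , λ Ae → Q⊆S (y∈ (A⊆P Ae))

    Q⊆H⁺ : ∀ {e x} → Q e x → Sat (H⁺ crit e) x 1# ε
    Q⊆H⁺ {e} {x} Qx = Allₚ.map⁺ (All.map (λ {f} 0≤f → ≤-respʳ-≈ (sym (⟦setSlope⟧ _ f x 1# ε))
      (+-nonNeg 0≤f (*-nonNeg (0≤slope crit (em {InΣ crit e})) (<⇒≤ 0<ε)))) Qx)

    σ-unrelaxed : ∀ {e x} (dec : Dec (InΣ crit e)) → InΣ crit e → Sat (map (setSlope (slope crit dec)) (H e)) x 1# ε → Q e x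
    σ-unrelaxed {x = x} (yes _) _ sat = All.map (λ {f} → ≤-respʳ-≈
      (trans (⟦setSlope⟧ 0# f x 1# ε) (trans (+-congˡ (zeroˡ ε)) (+-identityʳ _)))) (Allₚ.map⁻ sat)
    σ-unrelaxed (no e∉σ) e∈σ _ = contradiction e∈σ e∉σ

    removed : ∀ {A} → Satisfiable A → (∀ i → A (σ i)) → ¬ Face T A
    -- The bound `x ≺ m` is read off an arbitrary element of `A`, because `σ` may be empty; for
    -- `d = 0` it always is.
    removed (e , Ae) σ⊆A (x , x∈) = blocks x (λ i → σ-unrelaxed (em {InΣ crit (σ i)}) (i , ≡.refl) (proj₁ (x∈ (σ⊆A i)))) (proj₂ (x∈ Ae))

    -- A set through `m` may miss `q`, but close enough to `m` on the segment its inequalities fail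
    -- by less than `ε`. There are finitely many inequalities, so one `δ` works for all sets.
    near : ∀ q → ∃ λ δ → 0# < δ × δ ≤ 1# × (∀ {e} → Q e m → All (λ f → 0# ≤ ⟦ f ⟧ (segmentPoint δ m q) 1# 0# + 1# * ε) (H e))
    near q = let δ , 0<δ , δ≤1 , δ≤ = lowerBound (0# <_) 0<1 {map bnd forms} (Allₚ.map⁺ (All.tabulate (λ {f} _ → proj₁ (proj₂ (small f)))))
             in δ , 0<δ , δ≤1 , λ {e} m∈ → All.tabulate (λ {f} f∈ → relaxed 0<δ δ≤1 f (All.lookup m∈ f∈)
                  (All.lookup δ≤ (∈-map⁺ bnd (∈-concat⁺′ f∈ (∈-map⁺ H (elems-complete e))))))
      where
      forms : List (Form d)
      forms = concat (map H elems)
      small : ∀ f → ∃ λ δ → 0# < δ × (∀ {δ′} → 0# ≤ δ′ → δ′ ≤ δ → δ′ * (- ⟦ f ⟧ q 1# 0#) < ε)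
      small f = small-multiple (- ⟦ f ⟧ q 1# 0#) 0<ε
      bnd : Form d → Carrier
      bnd f = proj₁ (small f)
      relaxed : ∀ {δ} → 0# < δ → δ ≤ 1# → ∀ f → 0# ≤ ⟦ f ⟧ m 1# 0# → δ ≤ bnd f → 0# ≤ ⟦ f ⟧ (segmentPoint δ m q) 1# 0# + 1# * ε
      relaxed {δ} 0<δ δ≤1 f 0≤fm δ≤bnd = ≤-respʳ-≈ (sym (begin
        ⟦ f ⟧ (segmentPoint δ m q) 1# 0# + 1# * ε
          ≈⟨ +-congʳ (⟦⟧-segment f δ m q 0#) ⟩
        (1# - δ) * ⟦ f ⟧ m 1# 0# + δ * ⟦ f ⟧ q 1# 0# + 1# * ε
          ≈⟨ solve 4 (λ a d v e → a :+ d :* v :+ con (+ 1) :* e := a :+ (e :- d :* (:- v))) refl ((1# - δ) * ⟦ f ⟧ m 1# 0#) δ (⟦ f ⟧ q 1# 0#) ε ⟩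
        (1# - δ) * ⟦ f ⟧ m 1# 0# + (ε - δ * (- ⟦ f ⟧ q 1# 0#)) ∎))
        (+-nonNeg (*-nonNeg (≤⇒nonNeg δ≤1) 0≤fm) (≤⇒nonNeg (<⇒≤ (proj₂ (proj₂ (small f)) (<⇒≤ 0<δ) δ≤bnd))))

    -- The witness moves from `m` slightly towards the escape point of `i`. The members of `A` in
    -- `σ` contain both ends of this segment, and the other members are relaxed enough to follow.
    descend : ∀ {A i} → ¬ A (σ i) → Common Q A m → Face T A
    descend {A} {i} ¬A m∈A = segmentPoint δ m q , λ {e} Ae →
      inH⁺ (em {InΣ crit e}) Ae , segment-≺ (inj₂ λ _ → refl) (proj₂ (proj₂ (escape i))) 0<δ δ≤1
      where
      q : Point
      q = proj₁ (escape i)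
      δ : Carrier
      δ = proj₁ (near q)
      0<δ : 0# < δ
      0<δ = proj₁ (proj₂ (near q))
      δ≤1 : δ ≤ 1#
      δ≤1 = proj₁ (proj₂ (proj₂ (near q)))
      inH⁺ : ∀ {e} (dec : Dec (InΣ crit e)) → A e → Sat (map (setSlope (slope crit dec)) (H e)) (segmentPoint δ m q) 1# ε
      inH⁺ {e} (yes (j , ≡.refl)) Ae = Allₚ.map⁺ (All.map
        (λ {f} → ≤-respʳ-≈ (sym (trans (⟦setSlope⟧ 0# f _ 1# ε) (trans (+-congˡ (zeroˡ ε)) (+-identityʳ _)))))
        (convex (Q-convex pk e) (m∈A Ae) (proj₁ (proj₂ (escape i)) j (λ { ≡.refl → ¬A Ae })) δ (<⇒≤ 0<δ) δ≤1))
      inH⁺ {e} (no _) Ae = Allₚ.map⁺ (All.map (λ {f} → ≤-respʳ-≈ (sym (⟦setSlope⟧ 1# f _ 1# ε))) (proj₂ (proj₂ (proj₂ (near q))) (m∈A Ae)))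

    kept : ∀ {A} → Satisfiable A → Face S A → ¬ (∀ i → A (σ i)) → Face T A
    kept {A} sat face σ⊈A with low-point sat face
    ... | x , x∈ , inj₁ x≺m = x , λ Ae → Q⊆H⁺ (x∈ Ae) , x≺m
    ... | x , x∈ , inj₂ x≈m = let i , ¬A = decidable-stable em (λ ∄ → σ⊈A (λ i → decidable-stable em (λ ¬A → ∄ (i , ¬A))))
                              in descend ¬A (λ {e} Ae → respects (Q-convex pk e) x≈m (x∈ Ae))

    collapseOf : Collapse S
    collapseOf = record
      { T = T ; T-convex = λ e → ∩-convex (Sat-convex (H⁺ crit e) ε) (≺-convex m)
      ; size≤d = size≤d crit ; σ = σ ; τ = τ crit ; σ⊆τ = m∈
      ; τ-inhabited = let e , A₀e = A₀-inhabited in e , proj₁ m-spec A₀e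
      ; τ-face = m , Q⊆S
      ; star⊆τ = star⊆τ crit ; kept = kept ; T⇒S = T⇒S ; removed = removed }

  collapse : (S : E → Subset) → (∀ e → IsConvexSubset (S e)) → ∀ {e x} → S e x → Collapse S
  collapse S S-convex {e} {x} x∈S = collapseOf {crit = crit} (slack crit)
    where
    crit = critical (peak (Hulls.polyhedra S S-convex) e x x∈S)

-- Walks between transversals

module Reconfiguration (em : ExcludedMiddle 0ℓ) (ℝ : RealField) (d n M : ℕ) (2+d≤n : 2 ℕ.+ d ℕ.≤ n) where
  open Euclidean ℝ d
  open RealField ℝ using (0#)

  Element : Set
  Element = Fin n × Fin M

  elements : List Element
  elements = cartesianProduct (allFin n) (allFin M)

  elements-complete : ∀ e → e ∈ elements
  elements-complete (i , j) = ∈-cartesianProduct⁺ (∈-allFin i) (∈-allFin j)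

  open Collapsing em ℝ d elements elements-complete using (Face; Collapse; module Collapse; collapse) public
  open Enumeration em elements elements-complete

  Choice : Set
  Choice = Fin n → Fin M

  ⟪_⟫ : Choice → Pred Element 0ℓ
  ⟪ t ⟫ (i , j) = j ≡ t i

  infixl 10 _∖_
  _∖_ : Choice → Fin n → Pred Element 0ℓ
  (t ∖ k) (i , j) = i ≢ k × j ≡ t i

  IsVertex : (Element → Subset) → Choice → Set
  IsVertex S t = ¬ Face S ⟪ t ⟫

  -- The constructor `same` makes up for function extensionality, and `edge` may leave the
  -- coordinate `k` unchanged, so no construction has to check whether a step really moves.
  data Step (S : Element → Subset) (t t′ : Choice) : Set where
    same : t ≗ t′ → Step S t t′
    edge : ∀ k → (∀ {i} → i ≢ k → t i ≡ t′ i) → ¬ Face S (t ∖ k) → Step S t t′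

  Walk : (Element → Subset) → Choice → Choice → Set
  Walk S = Star (Step S)

  Face-mono : ∀ {S} {A B : Pred Element 0ℓ} → A ⊆ B → Face S B → Face S A
  Face-mono A⊆B (x , x∈) = x , λ Ae → x∈ (A⊆B Ae)

  Step-sym : ∀ {S t t′} → Step S t t′ → Step S t′ t
  Step-sym (same t≗t′)        = same (λ i → ≡.sym (t≗t′ i))
  Step-sym (edge k agree ¬face) = edge k (λ i≢k → ≡.sym (agree i≢k))
    (λ face → ¬face (Face-mono (λ { (i≢k , ≡.refl) → i≢k , agree i≢k }) face))

  missed : ∀ {k} → k ℕ.< n → (f : Fin k → Fin n) → ∃ λ y → ∀ i → f i ≢ y
  missed k<n f = decidable-stable em λ surjective →
    let preimage : ∀ y → ∃ λ i → f i ≡ y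
        preimage y = decidable-stable em λ none → surjective (y , λ i fi≡y → none (i , fi≡y))
        i , j , i<j , eq = Finₚ.pigeonhole k<n (proj₁ ∘ preimage)
    in Finₚ.<⇒≢ i<j (≡.trans (≡.sym (proj₂ (preimage i))) (≡.trans (≡.cong f eq) (proj₂ (preimage j))))

  another : ∀ (k : Fin n) → ∃ λ i → i ≢ k
  another k = let i , k≢i = missed (ℕₚ.≤-trans (s≤s (s≤s z≤n)) 2+d≤n) (λ (_ : Fin 1) → k)
              in i , λ i≡k → k≢i zero (≡.sym i≡k)

  ∖-inhabited : ∀ t k → Satisfiable (t ∖ k)
  ∖-inhabited t k = let i , i≢k = another k in (i , t i) , i≢k , ≡.refl

  -- Coordinates are switched from `u` to `v` one at a time, so whatever `u` and `v` share is kept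
  -- all along the walk.
  module Interpolation (u v : Choice) where
    mix : ℕ → Choice
    mix p i with toℕ i ℕₚ.<? p
    ... | yes _ = v i
    ... | no _  = u i

    mix-< : ∀ {p i} → toℕ i ℕ.< p → mix p i ≡ v i
    mix-< {p} {i} i<p with toℕ i ℕₚ.<? p
    ... | yes _   = ≡.refl
    ... | no i≮p = contradiction i<p i≮p

    mix-≮ : ∀ {p i} → ¬ (toℕ i ℕ.< p) → mix p i ≡ u i
    mix-≮ {p} {i} i≮p with toℕ i ℕₚ.<? p
    ... | yes i<p = contradiction i<p i≮p
    ... | no _    = ≡.refl

    mix-suc : ∀ {p i} → toℕ i ≢ p → mix p i ≡ mix (suc p) i
    mix-suc {p} {i} i≢p with ℕₚ.<-cmp (toℕ i) p
    ... | tri< i<p _ _ = ≡.trans (mix-< i<p) (≡.sym (mix-< (ℕₚ.m≤n⇒m≤1+n i<p)))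

    ... | tri≈ _ i≡p _ = contradiction i≡p i≢p
    ... | tri> _ _ p<i = ≡.trans (mix-≮ (ℕₚ.<-asym p<i)) (≡.sym (mix-≮ (λ i<1+p → ℕₚ.<-irrefl ≡.refl (ℕₚ.≤-trans p<i (ℕₚ.≤-pred i<1+p)))))

    Between : Choice → Set
    Between t = ∀ i → t i ≡ u i ⊎ t i ≡ v i

    between : ∀ p → Between (mix p)
    between p i with toℕ i ℕₚ.<? p
    ... | yes _ = inj₂ ≡.refl
    ... | no _  = inj₁ ≡.refl

    interpolate : ∀ {S} → (∀ {t t′ k} → Between t → Between t′ → (∀ {i} → i ≢ k → t i ≡ t′ i) → Step S t t′) → Walk S u v
    interpolate {S} step = walk n ◅◅ (same (λ i → mix-< (Finₚ.toℕ<n i)) ◅ done)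
      where
      walk : ∀ p → Walk S u (mix p)
      walk zero    = same (λ i → ≡.sym (mix-≮ {zero} {i} (λ ()))) ◅ done
      walk (suc p) with p ℕₚ.<? n
      ... | yes p<n = walk p ◅◅ (step (between p) (between (suc p))
                        (λ i≢k → mix-suc (λ i≡p → i≢k (Finₚ.toℕ-injective (≡.trans i≡p (≡.sym (Finₚ.toℕ-fromℕ< p<n)))))) ◅ done)
      ... | no p≮n  = walk p ◅◅ (same (λ i → mix-suc (λ i≡p → p≮n (≡.subst (ℕ._< n) i≡p (Finₚ.toℕ<n i)))) ◅ done)

  Linked : (Element → Subset) → Set
  Linked S = ∃ (IsVertex S) × (∀ u v → IsVertex S u → IsVertex S v → Walk S u v)

  Colour : Fin n → Pred Element 0ℓ
  Colour i (i′ , _) = i′ ≡ i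

  colour-escapes : ∀ {S A} → Face S A → ∀ {i} → ¬ Face S (Colour i) → ∃ λ j → ¬ A (i , j)
  colour-escapes (x , x∈) {i} ¬face = decidable-stable em λ none →
    ¬face (x , λ { {_ , j} ≡.refl → x∈ (decidable-stable em λ ¬A → none (j , ¬A)) })

  -- Undoing a collapse

  module Lifting {S : Element → Subset} (C : Collapse S) (colourless : ∀ i → ¬ Face S (Colour i)) where
    open Collapse C

    Contains : Choice → Set
    Contains t = ∀ l → ⟪ t ⟫ (σ l)

    InσColour : Fin n → Set
    InσColour i = ∃ λ l → proj₁ (σ l) ≡ i

    Contains-agree : ∀ {t t′} → Contains t → Contains t′ → ∀ {i} → InσColour i → t i ≡ t′ i
    Contains-agree c c′ (l , ≡.refl) = ≡.trans (≡.sym (c l)) (c′ l)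

    agree⇒Contains : ∀ {t t′} → Contains t → (∀ {i} → InσColour i → t i ≡ t′ i) → Contains t′
    agree⇒Contains c agree l = ≡.trans (c l) (agree (l , ≡.refl))

    freeColour : ∃ λ a → ¬ InσColour a
    freeColour = let a , p = missed (ℕₚ.≤-trans (s≤s (ℕₚ.m≤n⇒m≤1+n size≤d)) 2+d≤n) (proj₁ ∘ σ) in a , λ (l , eq) → p l eq

    -- Here `n ≥ d + 2` is used in full: the colours of `σ` and `k` are at most `d + 1` in number.
    freeColour≢ : ∀ k → ∃ λ a → ¬ InσColour a × a ≢ k
    freeColour≢ k = let a , p = missed (ℕₚ.≤-trans (s≤s (s≤s size≤d)) 2+d≤n) (k ◂ (proj₁ ∘ σ))
                    in a , (λ (l , eq) → p (suc l) eq) , λ a≡k → p zero (≡.sym a≡k)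

    -- The element of colour `k` keeps every intermediate choice outside `τ`. A step in a colour
    -- that is neither `k` nor a colour of `σ` leaves behind a set that still contains `σ` and this
    -- element, so by `star⊆τ` it is not a face.
    connect : ∀ {u v k} → Contains u → Contains v → u k ≡ v k → ¬ τ (k , u k) → Walk S u v
    connect {u} {v} {k} cu cv uk≡vk k∉τ = interpolate step
      where
      open Interpolation u v
      contains : ∀ {t} → Between t → Contains t
      contains b = agree⇒Contains cu λ {i} inσ → [ ≡.sym , (λ eq → ≡.trans (Contains-agree cu cv inσ) (≡.sym eq)) ]′ (b i)
      fixed : ∀ {t} → Between t → t k ≡ u k
      fixed b = [ id , (λ eq → ≡.trans eq (≡.sym uk≡vk)) ]′ (b k)
      everywhere : ∀ {t t′ : Choice} {j} → (∀ {i} → i ≢ j → t i ≡ t′ i) → t j ≡ t′ j → t ≗ t′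
      everywhere {j = j} agree eq i with i Finₚ.≟ j
      ... | yes ≡.refl = eq
      ... | no i≢j     = agree i≢j
      step : ∀ {t t′ j} → Between t → Between t′ → (∀ {i} → i ≢ j → t i ≡ t′ i) → Step S t t′
      step {t} {t′} {j} b b′ agree with j Finₚ.≟ k | em {InσColour j}
      ... | yes ≡.refl | _       = same (everywhere agree (≡.trans (fixed b) (≡.sym (fixed b′))))
      ... | no _       | yes inσ = same (everywhere agree (Contains-agree (contains b) (contains b′) inσ))
      ... | no j≢k     | no ¬inσ = edge j agree λ face → k∉τ (≡.subst (λ x → τ (k , x)) (fixed b)
              (star⊆τ (∖-inhabited t j) face (λ l → (λ eq → ¬inσ (l , eq)) , contains b l) ((λ k≡j → j≢k (≡.sym k≡j)) , ≡.refl)))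

    outside : ∀ i → ∃ λ j → ¬ τ (i , j)
    outside i = colour-escapes τ-face (colourless i)

    -- A meeting point determined by `σ` alone: choices containing `σ` agree on its colours, and all
    -- other coordinates are fixed outside `τ`.
    hub : Choice → Choice
    hub t i with em {InσColour i}
    ... | yes _ = t i
    ... | no _  = proj₁ (outside i)

    hub-in : ∀ {t i} → InσColour i → hub t i ≡ t i
    hub-in {t} {i} inσ with em {InσColour i}
    ... | yes _   = ≡.refl
    ... | no ¬inσ = contradiction inσ ¬inσ

    hub-out : ∀ {t i} → ¬ InσColour i → hub t i ≡ proj₁ (outside i)
    hub-out {t} {i} ¬inσ with em {InσColour i}
    ... | yes inσ = contradiction inσ ¬inσ
    ... | no _    = ≡.refl

    hub-agree : ∀ {t t′} → Contains t → Contains t′ → hub t ≗ hub t′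
    hub-agree {t} {t′} c c′ i with em {InσColour i}
    ... | yes inσ = Contains-agree c c′ inσ
    ... | no _    = ≡.refl

    hub-∉τ : ∀ t {a} → ¬ InσColour a → ¬ τ (a , hub t a)
    hub-∉τ t {a} ¬inσ = ≡.subst (λ x → ¬ τ (a , x)) (≡.sym (hub-out ¬inσ)) (proj₂ (outside a))

    hub-contains : ∀ {t} → Contains t → Contains (hub t)
    hub-contains c = agree⇒Contains c (λ inσ → ≡.sym (hub-in inσ))

    -- Among the choices containing `σ` these are exactly the vertices for `S`, since `τ` is the
    -- largest face above `σ`.
    Clear : Choice → Set
    Clear t = Contains t × ¬ (⟪ t ⟫ ⊆ τ)

    hub-clear : ∀ {t} → Contains t → Clear (hub t)
    hub-clear {t} c = hub-contains c , λ ⊆τ → let a , ¬inσ = freeColour in hub-∉τ t ¬inσ (⊆τ ≡.refl)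

    ⟪⟫-inhabited : ∀ t → Satisfiable ⟪ t ⟫
    ⟪⟫-inhabited t = let a , _ = freeColour in (a , t a) , ≡.refl

    clear-vertex : ∀ {t} → Clear t → IsVertex S t
    clear-vertex {t} (c , ⊈τ) face = ⊈τ (star⊆τ (⟪⟫-inhabited t) face c)

    vertex-clear : ∀ {t} → Contains t → IsVertex S t → Clear t
    vertex-clear c vertex = c , λ ⊆τ → vertex (Face-mono ⊆τ τ-face)

    -- First everything but one coordinate outside τ is moved, and then, with
    -- another free coordinate outside τ, that coordinate too.
    to-hub : ∀ {t} → Clear t → Walk S t (hub t)
    to-hub {t} (c , ⊈τ) = connect {t} {g} {k} c cg (≡.sym gk≡tk) k∉τ ◅◅
      connect {g} {hub t} {a} cg (hub-contains {t} c) ga≡ha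
        (λ a∈τ → hub-∉τ t ¬inσ (≡.subst (λ x → τ (a , x)) ga≡ha a∈τ))
      where
      escaping : ∃ λ k → ¬ τ (k , t k)
      escaping = decidable-stable em λ none → ⊈τ λ { {i , _} ≡.refl → decidable-stable em λ ∉τ → none (i , ∉τ) }
      k : Fin n
      k = proj₁ escaping
      k∉τ : ¬ τ (k , t k)
      k∉τ = proj₂ escaping
      a : Fin n
      a = proj₁ (freeColour≢ k)
      ¬inσ : ¬ InσColour a
      ¬inσ = proj₁ (proj₂ (freeColour≢ k))
      g : Choice
      g i with i Finₚ.≟ k
      ... | yes _ = t i
      ... | no _  = hub t i
      gk≡tk : g k ≡ t k
      gk≡tk with k Finₚ.≟ k
      ... | yes _  = ≡.refl
      ... | no k≢k = contradiction ≡.refl k≢k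
      ga≡ha : g a ≡ hub t a
      ga≡ha with a Finₚ.≟ k
      ... | yes a≡k = contradiction a≡k (proj₂ (proj₂ (freeColour≢ k)))
      ... | no _    = ≡.refl
      g-in : ∀ {i} → InσColour i → t i ≡ g i
      g-in {i} inσ with i Finₚ.≟ k
      ... | yes _ = ≡.refl
      ... | no _  = ≡.sym (hub-in inσ)
      cg : Contains g
      cg = agree⇒Contains {t} {g} c g-in

    clear-connected : ∀ {t t′} → Clear t → Clear t′ → Walk S t t′
    clear-connected c c′ = to-hub c ◅◅ (same (hub-agree (proj₁ c) (proj₁ c′)) ◅ reverse Step-sym (to-hub c′))

    -- A vertex for `T` that is not one for `S` must contain `σ`. Any clear choice may then stand in
    -- for it, as all of these are connected.
    Shadow : Choice → Choice → Set
    Shadow t r = IsVertex S r × (r ≗ t ⊎ Contains t × Clear r)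

    shadow-clear : ∀ {t r} → Contains t → Shadow t r → Clear r
    shadow-clear c (vertex , inj₁ r≗t)       = vertex-clear (agree⇒Contains c (λ {i} _ → ≡.sym (r≗t i))) vertex
    shadow-clear c (vertex , inj₂ (_ , clear)) = clear

    shadow-connected : ∀ {t r r′} → Shadow t r → Shadow t r′ → Walk S r r′
    shadow-connected s@(_ , inj₂ (c , clear)) s′ = clear-connected clear (shadow-clear c s′)
    shadow-connected s s′@(_ , inj₂ (c , clear)) = clear-connected (shadow-clear c s) clear
    shadow-connected (_ , inj₁ r≗t) (_ , inj₁ r′≗t) = same (λ i → ≡.trans (r≗t i) (≡.sym (r′≗t i))) ◅ done

    shadow-self : ∀ {t} → IsVertex S t → Shadow t t
    shadow-self vertex = vertex , inj₁ (λ _ → ≡.refl)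

    lift-step : ∀ {t t′ r} → Step T t t′ → Shadow t r → ∃ λ r′ → Shadow t′ r′ × Walk S r r′
    lift-step {r = r} (same t≗t′) (vertex , inj₁ r≗t) = r , (vertex , inj₁ (λ i → ≡.trans (r≗t i) (t≗t′ i))) , done
    lift-step {r = r} (same t≗t′) (vertex , inj₂ (c , clear)) = r , (vertex , inj₂ (agree⇒Contains c (λ {i} _ → t≗t′ i) , clear)) , done
    lift-step {t} {t′} {r} (edge k agree ¬faceT) s with em {Face S (t ∖ k)}
    ... | no ¬face = t′ , shadow-self t′-vertex , shadow-connected s (shadow-self t-vertex) ◅◅ (edge k agree ¬face ◅ done)
      where
      t-vertex : IsVertex S t
      t-vertex = ¬face ∘ Face-mono proj₂
      t′-vertex : IsVertex S t′
      t′-vertex = ¬face ∘ Face-mono (λ { (i≢k , ≡.refl) → agree i≢k })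
    ... | yes face = hub t′ , (clear-vertex (hub-clear c′) , inj₂ (c′ , hub-clear c′)) ,
                     to-hub r-clear ◅◅ (same (hub-agree (proj₁ r-clear) c′) ◅ done)
      where
      σ⊆ : ∀ l → (t ∖ k) (σ l)
      -- If some `σ l` were missing, `kept` would turn this face of `S` into a face of `T`, against
      -- the given edge.
      σ⊆ = decidable-stable em (λ σ⊈ → ¬faceT (kept (∖-inhabited t k) face σ⊈))
      c′ : Contains t′
      c′ l = ≡.trans (proj₂ (σ⊆ l)) (agree (proj₁ (σ⊆ l)))
      r-clear : Clear r
      r-clear = shadow-clear (λ l → proj₂ (σ⊆ l)) s

    lift-walk : ∀ {t t′ r} → Walk T t t′ → Shadow t r → ∃ λ r′ → Shadow t′ r′ × Walk S r r′
    lift-walk {r = r} done s = r , s , done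
    lift-walk (step ◅ steps) s =
      let r₁ , s₁ , w₁ = lift-step step s
          r₂ , s₂ , w₂ = lift-walk steps s₁
      in r₂ , s₂ , w₁ ◅◅ w₂

    lift : Linked T → Linked S
    lift ((t , t-vertex) , walks) = vertex (em {Face S ⟪ t ⟫}) , λ u v u-vertex v-vertex →
      let r , s , w = lift-walk (walks u v (u-vertex ∘ T⇒S) (v-vertex ∘ T⇒S)) (shadow-self u-vertex)
      in w ◅◅ shadow-connected s (shadow-self v-vertex)
      where
      vertex : Dec (Face S ⟪ t ⟫) → ∃ (IsVertex S)
      vertex (no ¬face) = t , ¬face
      -- A vertex for `T` that is a face of `S` contains `σ`, so its hub is defined by `σ` and is a
      -- vertex for `S`.
      vertex (yes face) = hub t , clear-vertex (hub-clear (decidable-stable em λ ¬c → t-vertex (kept (⟪⟫-inhabited t) face ¬c)))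

  linked-empty : ∀ {S} → (∀ {e x} → ¬ S e x) → (∀ i → ¬ Face S (Colour i)) → Linked S
  linked-empty {S} empty colourless =
    -- Every set of elements disjoint from a colour would do here; the empty face merely yields some
    -- index in `Fin M` for each colour.
    ((λ i → proj₁ (colour-escapes {A = λ _ → ⊥} ((λ _ → 0#) , λ ()) (colourless i))) , λ face → noFace (proj₁ (missed 0<n (λ ())) , _) ≡.refl face) ,
    λ u v _ _ → Interpolation.interpolate u v (λ {t} {_} {k} _ _ agree → edge k agree (let e , e∈ = ∖-inhabited t k in noFace e e∈))
    where
    0<n : 0 ℕ.< n
    0<n = ℕₚ.≤-trans (s≤s z≤n) 2+d≤n
    noFace : ∀ {A : Pred Element 0ℓ} e → A e → ¬ Face S A
    noFace e Ae (x , x∈) = empty (x∈ Ae)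

  -- The list `faces` has to cover the codes of the nonempty faces, possibly with others among them.
  -- Every collapse removes the face `τ`, so the code of `τ` can be struck off and the list shrinks.
  linked : ∀ N S → (∀ e → IsConvexSubset (S e)) → (∀ i → ¬ Face S (Colour i)) →
           ∀ faces → length faces ℕ.< N → (∀ {k} → Satisfiable (P k) → Face S (P k) → k ∈ faces) → Linked S
  linked (suc N) S convex colourless faces (s≤s len≤N) covers with em {∃ λ e → Satisfiable (S e)}
  ... | no empty = linked-empty (λ {e} {x} Sx → empty (e , x , Sx)) colourless
  ... | yes (e , x , x∈S) = Lifting.lift C colourless
          (linked N T T-convex (λ i → colourless i ∘ T⇒S) faces′
            (ℕₚ.≤-trans (Listₚ.filter-notAll (λ k → em {k ≢ k₀}) faces (lose k₀∈faces (λ k₀≢k₀ → k₀≢k₀ ≡.refl))) len≤N) covers′)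
    where
    C : Collapse S
    C = collapse S convex x∈S
    open Collapse C
    k₀ : Fin K
    k₀ = proj₁ (P-complete τ)
    P⊆τ : P k₀ ⊆ τ
    P⊆τ = proj₁ (proj₂ (P-complete τ))
    τ⊆P : τ ⊆ P k₀
    τ⊆P = proj₂ (proj₂ (P-complete τ))
    P-inhabited : Satisfiable (P k₀)
    P-inhabited = let e , τe = τ-inhabited in e , τ⊆P τe
    k₀∈faces : k₀ ∈ faces
    k₀∈faces = covers P-inhabited (Face-mono P⊆τ τ-face)
    faces′ : List (Fin K)
    faces′ = filter (λ k → em {k ≢ k₀}) faces
    covers′ : ∀ {k} → Satisfiable (P k) → Face T (P k) → k ∈ faces′
    covers′ sat face = ∈-filter⁺ (λ k → em {k ≢ k₀}) (covers sat (T⇒S face))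
      (λ { ≡.refl → removed P-inhabited (λ l → τ⊆P (σ⊆τ l)) face })

  connected : ∀ S → (∀ e → IsConvexSubset (S e)) → (∀ i → ¬ Face S (Colour i)) → Linked S
  connected S convex colourless = linked (suc (length (allFin K))) S convex colourless (allFin K) ℕₚ.≤-refl (λ {k} _ _ → ∈-allFin k)

-- From transversals of indices to tuples of sets

open import Data.Nat.Base using (_+_; _≥_)

bounded : ∀ {n} (f : Fin n → ℕ) → ∃ λ M → ∀ i → f i ℕ.≤ M
bounded {zero}  f = 0 , λ ()
bounded {suc n} f = let M , f≤M = bounded (f ∘ suc) in
  f zero ℕ.⊔ M , λ { zero → ℕₚ.m≤m⊔n (f zero) M ; (suc i) → ℕₚ.≤-trans (f≤M i) (ℕₚ.m≤n⊔m (f zero) M) }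

module Transfer (em : ExcludedMiddle 0ℓ) (ℝ : RealField) (d n : ℕ) (F : Fin n → Euclidean.Family ℝ d)
                (F-convex : ∀ i → All (Euclidean.IsConvexSubset ℝ d) (F i))
                (F-empty : ∀ i → Empty (Euclidean.⋂ᶠ ℝ d (F i))) (n≥d+2 : n ≥ d + 2) where
  open Euclidean ℝ d
  open RealField ℝ using (0#)
  open Vertex

  M : ℕ
  M = proj₁ (bounded (length ∘ F))

  open Reconfiguration em ℝ d n M (≡.subst (ℕ._≤ n) (ℕₚ.+-comm d 2) n≥d+2)

  inject : ∀ i → Fin (length (F i)) → Fin M
  inject i k = inject≤ k (proj₂ (bounded (length ∘ F)) i)

  -- The intersection of an empty family is all of the space and contains the origin, so the
  -- hypothesis forces every family to have a member.
  firstIndex : ∀ i → Fin (length (F i))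
  firstIndex i with F i | F-empty i
  ... | []    | empty = contradiction (λ ()) (empty (λ _ → 0#))
  ... | _ ∷ _ | _     = zero

  -- Indices beyond the end of a family repeat its first member.
  position : ∀ i → Fin M → Fin (length (F i))
  position i j with toℕ j ℕₚ.<? length (F i)
  ... | yes j<len = fromℕ< j<len
  ... | no _      = firstIndex i

  position-inject : ∀ i k → position i (inject i k) ≡ k
  position-inject i k with toℕ (inject i k) ℕₚ.<? length (F i)
  ... | yes p = Finₚ.toℕ-injective (≡.trans (Finₚ.toℕ-fromℕ< p) (Finₚ.toℕ-inject≤ k _))
  ... | no ¬p = contradiction (≡.subst (ℕ._< length (F i)) (≡.sym (Finₚ.toℕ-inject≤ k _)) (Finₚ.toℕ<n k)) ¬p

  S : Element → Subset
  S (i , j) = lookup (F i) (position i j)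

  S-convex : ∀ e → IsConvexSubset (S e)
  S-convex (i , j) = All.lookup (F-convex i) (∈-lookup (position i j))

  colourless : ∀ i → ¬ Face S (Colour i)
  colourless i (x , x∈) = F-empty i x λ k → ≡.subst (λ l → lookup (F i) l x) (position-inject i k) (x∈ {i , inject i k} ≡.refl)

  vertexOf : ∀ {t} → IsVertex S t → Vertex F
  vertexOf {t} ¬face = record
    { sets         = λ i → S (i , t i)
    ; member       = λ i → Any.map (λ { ≡.refl → ≐-refl }) (∈-lookup {xs = F i} (position i (t i)))
    ; intersection = λ x x∈ → ¬face (x , λ { {i , _} ≡.refl → x∈ i })
    }

  -- Different indices can denote extensionally equal sets, so one vertex may be represented by
  -- several choices.
  Represents : Choice → Vertex F → Set
  Represents t v = ∀ i → sets v i ≐ S (i , t i)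

  choiceOf : Vertex F → Choice
  choiceOf v i = inject i (Any.index (member v i))

  choiceOf-represents : ∀ v → Represents (choiceOf v) v
  choiceOf-represents v i = ≡.subst (λ l → sets v i ≐ lookup (F i) l) (≡.sym (position-inject i _)) (Anyₚ.lookup-index (member v i))

  choiceOf-vertex : ∀ v → IsVertex S (choiceOf v)
  choiceOf-vertex v (x , x∈) = intersection v x λ i → proj₂ (choiceOf-represents v i) (x∈ ≡.refl)

  open Graph (RG-CH F) using (Adjacent)

  adjacent : ∀ {t t′ u k} → Represents t u → (∀ {i} → i ≢ k → t i ≡ t′ i) → ¬ Face S (t ∖ k) → (v : IsVertex S t′) →
             ¬ (sets u k ≐ S (k , t′ k)) → Adjacent u (vertexOf v)
  adjacent {t} {u = u} {k} rep agree ¬face v differ = (k , differ , unique) , λ x x∈ →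
    ¬face (x , λ { {i , _} (i≢k , ≡.refl) → proj₁ (rep i) (x∈ (i , i≢k)) })
    where
    unique : ∀ {j} → ¬ (sets u j ≐ S (j , _)) → k ≡ j
    unique {j} differ′ = decidable-stable (k Finₚ.≟ j) λ k≢j →
      differ′ (≡.subst (λ x → sets u j ≐ S (j , x)) (agree (k≢j ∘ ≡.sym)) (rep j))

  transfer : ∀ {t t′ u} → Represents t u → Walk S t t′ → ∃ λ w → Star Adjacent u w × Represents t′ w
  transfer {u = u} rep done = u , done , rep
  transfer {u = u} rep (same t≗t′ ◅ steps) = transfer (λ i → ≡.subst (λ x → sets u i ≐ S (i , x)) (t≗t′ i) (rep i)) steps
  transfer {t} {u = u} rep (_◅_ {j = t₁} (edge k agree ¬face) steps) with em {sets u k ≐ S (k , t₁ k)}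
  -- The index changes but the set does not. Adjacent vertices must differ, so the walk stays where
  -- it is and only the representing choice is replaced.
  ... | yes equal = transfer rep₁ steps
    where
    rep₁ : Represents t₁ u
    rep₁ i with i Finₚ.≟ k
    ... | yes ≡.refl = equal
    ... | no i≢k     = ≡.subst (λ x → sets u i ≐ S (i , x)) (agree i≢k) (rep i)
  ... | no differ = let w , walk , rep′ = transfer {u = vertexOf {t₁} v₁} (λ _ → ≐-refl) steps
                    in w , adjacent {t} {t₁} {u} rep agree ¬face v₁ differ ◅ walk , rep′
    where
    v₁ : IsVertex S t₁
    v₁ = ¬face ∘ Face-mono (λ { (i≢k , ≡.refl) → agree i≢k })

  RG-CH-connected : Connected (RG-CH F)
  RG-CH-connected =
    let (_ , vertex) , walks = connected S S-convex colourless
    in vertexOf vertex , λ u v →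
      let w , walk , rep = transfer (choiceOf-represents u) (walks _ _ (choiceOf-vertex u) (choiceOf-vertex v))
      in w , walk , λ i → ≐-trans (rep i) (≐-sym (choiceOf-represents v i))

theorem7p4 : ExcludedMiddle 0ℓ → (ℝ : RealField) (d n : ℕ) →
    let open Euclidean ℝ d in
    (F : Fin n → Family) →
    (∀ i → All IsConvexSubset (F i)) →
    (∀ i → Empty (⋂ᶠ (F i))) →
    n ≥ d + 2 →
    Connected (RG-CH F)
theorem7p4 = Transfer.RG-CH-connected
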